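{- Let $n$ be a positive integer and let $G=(G_1,\ldots,G_n)$ be a collection of $n$ graphs on a common vertex set $V$ with $|V|=n$, such that $\sigma_2(G_i)\ge n$ for all $i\in[n]$. Then for every pair of distinct vertices $u,v\in V$, at least one of the following holds: (B1) $G$ contains a rainbow Hamiltonian $u,v$-path; (B2) there exists a partition $V\setminus\{u,v\}=X\cup Y$ with $|X|,|Y|\ge 1$ such that for every $i\in[n]$, $G_i[X]$ and $G_i[Y]$ are disjoint cliques in $G_i$, and $u$ and $v$ are adjacent in $G_i$ to all vertices of $X\cup Y$; (B3) $n$ is even and there exists a partition $V=X\cup Y$ with $|X|=|Y|=n/2$ and $u,v\in X$ such that for every $i\in[n]$, the bipartite subgraph $G_i[X,Y]$ is complete bipartite.
   Context: For a graph $F$, $\sigma_2(F)=\min\{d_F(x)+d_F(y): x\ne y,\ xy\notin E(F)\}$ (the minimum degree sum over non-adjacent pairs). For a collection $G=(G_1,\ldots,G_m)$ of graphs on a common vertex set $V$ and a graph $H$ with $V(H)\subseteq V$, $G$ contains a rainbow $H$ if there is an injection $c:E(H)\to[m]$ with $e\in E(G_{c(e)})$ for every $e\in E(H)$. A Hamiltonian $u,v$-path is a path through all vertices of $V$ with endpoints $u$ and $v$. $G_i[X,Y]$ denotes the bipartite subgraph of $G_i$ consisting of edges between $X$ and $Y$. -}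

module Defs where

open import Data.Nat using (ℕ; zero; suc; _+_; _≥_)
open import Data.Bool using (Bool; true; false; if_then_else_)
open import Data.Fin using (Fin; zero; suc; fromℕ; inject₁)
open import Data.Product using (Σ; ∃; ∃-syntax; _×_; _,_)
open import Data.Sum using (_⊎_)
open import Relation.Nullary using (¬_)
open import Relation.Binary.PropositionalEquality using (_≡_; _≢_)
open import Function.Definitions using (Injective)

record Graph (n : ℕ) : Set where
  field
    adj     : Fin n → Fin n → Bool
    sym     : ∀ x y → adj x y ≡ adj y x
    irrefl  : ∀ x → adj x x ≡ false
open Graph public

_~[_]_ : ∀ {n} → Fin n → Graph n → Fin n → Set
x ~[ F ] y = adj F x y ≡ true

count : ∀ {n} → (Fin n → Bool) → ℕ
count {zero}  f = 0
count {suc n} f = (if f zero then 1 else 0) + count (λ i → f (suc i))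

deg : ∀ {n} → Graph n → Fin n → ℕ
deg F x = count (adj F x)

-- σ₂(F) ≥ k : every pair of distinct non-adjacent vertices has degree sum ≥ k
-- (vacuous for complete graphs, matching σ₂ = min ∅ = ∞).
σ₂≥ : ∀ {n} → Graph n → ℕ → Set
σ₂≥ F k = ∀ x y → x ≢ y → ¬ (x ~[ F ] y) → deg F x + deg F y ≥ k

Collection : ℕ → ℕ → Set
Collection m n = Fin m → Graph n

-- Rainbow Hamiltonian u,v-path in a collection on vertex set Fin (suc k):
-- a bijective (here: injective, equivalently bijective on Fin) ordering p of
-- all vertices starting at u and ending at v, together with an injective
-- colouring c of its k edges (edge i joins p i and p (i+1)) by graph indices
-- such that edge i lies in G (c i).
RainbowHamPath : ∀ {m k} → Collection m (suc k) → Fin (suc k) → Fin (suc k) → Set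
RainbowHamPath {m} {k} G u v =
  Σ (Fin (suc k) → Fin (suc k)) λ p →
  Σ (Fin k → Fin m) λ c →
    Injective _≡_ _≡_ p × p zero ≡ u × p (fromℕ k) ≡ v ×
    Injective _≡_ _≡_ c ×
    (∀ i → p (inject₁ i) ~[ G (c i) ] p (suc i))

OutcomeB2 : ∀ {m n} → Collection m n → Fin n → Fin n → Set
OutcomeB2 {m} {n} G u v =
  Σ (Fin n → Bool) λ inX →
  let X : Fin n → Set
      X w = w ≢ u × w ≢ v × inX w ≡ true
      Y : Fin n → Set
      Y w = w ≢ u × w ≢ v × inX w ≡ false
  in (∃[ x ] X x) × (∃[ y ] Y y) ×
     (∀ (i : Fin m) →
        (∀ x x′ → X x → X x′ → x ≢ x′ → x ~[ G i ] x′) ×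
        (∀ y y′ → Y y → Y y′ → y ≢ y′ → y ~[ G i ] y′) ×
        -- the two cliques are disjoint: no edges of G_i between X and Y
        (∀ x y → X x → Y y → ¬ (x ~[ G i ] y)) ×
        (∀ w → w ≢ u → w ≢ v → (u ~[ G i ] w) × (v ~[ G i ] w)))

OutcomeB3 : ∀ {m n} → Collection m n → Fin n → Fin n → Set
OutcomeB3 {m} {n} G u v =
  Σ (Fin n → Bool) λ inX →
    (∃[ h ] (n ≡ h + h × count inX ≡ h ×
             count (λ w → if inX w then false else true) ≡ h)) ×
    inX u ≡ true × inX v ≡ true ×
    (∀ (i : Fin m) x y → inX x ≡ true → inX y ≡ false → x ~[ G i ] y)

{-# OPTIONS --safe #-}

-- Delete u and v and call the remaining vertices inner.  Starting from single inner
-- vertices, maintain a rainbow linear forest covering them.  For ends x, y of two of its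
-- walks and unused colours α, β, no edge ab of the forest can satisfy x ~ a in α and
-- y ~ b in β unless ab can be exchanged for xa and yb, which joins two walks; comparing
-- this with the Ore condition for (α , β) and (β , α) brings the forest down to two walks,
-- or to one, in which case the same count attaches v and u.  With two walks all the counts
-- are equalities: on every edge ab exactly one of x ~ a, y ~ b holds.  If neither of x, y
-- sees the other walk, rotations show that no edge of any colour joins the two walks, which
-- is (B2).  Otherwise both walks alternate between the common neighbourhood J of all ends
-- and its complement, and rotations make every vertex outside J an end with any given
-- colour unused, so that it has neighbourhood J in every colour, which is (B3).
module Submission where

open import Defs
open import Data.Bool using (Bool; true; false; if_then_else_; _∨_)
open import Data.Bool.Properties using (∨-zeroʳ) renaming (_≟_ to _≟ᵇ_)
open import Data.Empty using (⊥; ⊥-elim)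
open import Data.Fin using (Fin; zero; suc; fromℕ; inject₁)
open import Data.Fin.Properties using (_≟_; any?; all?)
open import Data.List using (List; []; _∷_; length; map; allFin; tabulate)
open import Data.Nat using (ℕ; zero; suc; pred; _+_; _≤_; _<_; z≤n; s≤s; z<s)
open import Data.Nat.ListAction using () renaming (sum to listSum)
open import Data.Nat.Properties hiding (_≟_; suc-injective)
open import Data.Nat.Tactic.RingSolver using (solve; solve-∀)
open import Data.Product using (Σ; ∃-syntax; _×_; _,_; proj₁; proj₂)
open import Data.Sum using (_⊎_; inj₁; inj₂; [_,_]′)
open import Data.Vec.Functional using (head; tail) renaming (_∷_ to _∷ᶠ_; [] to []ᶠ)
open import Function using (_∘_; case_of_)
open import Function.Definitions using (Injective)
open import Relation.Binary.PropositionalEquality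
  using (_≡_; _≢_; _≗_; refl; cong; cong₂; subst; trans; module ≡-Reasoning)
  renaming (sym to ≡sym)
open import Algebra.Properties.CommutativeMonoid.Sum +-0-commutativeMonoid
  using (sum; sum-cong-≗; ∑-distrib-+)
open import Relation.Nullary using (¬_; Dec; yes; no; does; contradiction)
open import Relation.Nullary.Decidable using (dec-true; dec-false; map′; _×-dec_; _→-dec_)

-- An exchange spends two different colours, so one search bounds a mixed sum, the `α`-degree of `x`
-- plus the `β`-degree of `y`, whereas the Ore condition speaks of a single colour. Only the two
-- searches together regroup into one Ore sum for each colour. With l walks, E edges and o deleted
-- vertices, each search contributes at most E, the deleted vertices add at most 4o to the four
-- degrees, and the two Ore sums are at least 2n = 2(l + E + o). Hence l ≤ o: deleting two vertices
-- is what lets two walks survive, and for l = o the count has no slack.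
--
-- Walks are compared only through sums of arbitrary functions over their vertices and colours.
-- Covering, disjointness and degree counts then all come from one identity by choosing the
-- function, and regrouping a forest is plain arithmetic.

-- Arithmetic, finite sums and indicators

⟦_⟧ : Bool → ℕ
⟦ b ⟧ = if b then 1 else 0

⟦⟧≤1 : ∀ b → ⟦ b ⟧ ≤ 1
⟦⟧≤1 true  = ≤-refl
⟦⟧≤1 false = z≤n

⟦⟧-true : ∀ b → 0 < ⟦ b ⟧ → b ≡ true
⟦⟧-true true _ = refl

zero⊎pos : ∀ k → k ≡ 0 ⊎ 0 < k
zero⊎pos zero    = inj₁ refl
zero⊎pos (suc k) = inj₂ z<s

pos-+ : ∀ a {b} → 0 < a + b → 0 < a ⊎ 0 < b
pos-+ zero    p = inj₂ p
pos-+ (suc a) p = inj₁ z<s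

pos-+ˡ : ∀ {a} b → 0 < a → 0 < a + b
pos-+ˡ b p = ≤-trans p (m≤m+n _ b)

pos-+ʳ : ∀ a {b} → 0 < b → 0 < a + b
pos-+ʳ a p = ≤-trans p (m≤n+m _ a)

-- A linear consequence of summed hypotheses l ≤ r: the common part k cancels.
linear : ∀ k {p q l r} → l ≤ r → k + p ≡ l → r ≡ k + q → p ≤ q
linear k l≤r refl refl = +-cancelˡ-≤ k _ _ l≤r

≤-both-1 : ∀ {a b} → a ≤ 1 → b ≤ 1 → 2 ≤ a + b → 0 < a × 0 < b
≤-both-1 {zero}  _ b≤1 q = contradiction (≤-trans q b≤1) λ { (s≤s ()) }
≤-both-1 {suc a} {zero} a≤1 _ q = contradiction (≤-trans (subst (2 ≤_) (+-identityʳ _) q) a≤1) λ { (s≤s ()) }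
≤-both-1 {suc a} {suc b} _ _ _ = z<s , z<s

count≡sum : ∀ {n} (f : Fin n → Bool) → count f ≡ sum (⟦_⟧ ∘ f)
count≡sum {zero}  f = refl
count≡sum {suc n} f = cong (⟦ f zero ⟧ +_) (count≡sum (f ∘ suc))

sum-one : ∀ n → sum {n} (λ _ → 1) ≡ n
sum-one zero    = refl
sum-one (suc n) = cong suc (sum-one n)

sum-zero : ∀ n → sum {n} (λ _ → 0) ≡ 0
sum-zero zero    = refl
sum-zero (suc n) = sum-zero n

sum-mono : ∀ {n} {f g : Fin n → ℕ} → (∀ i → f i ≤ g i) → sum f ≤ sum g
sum-mono {zero}  f≤g = z≤n
sum-mono {suc n} f≤g = +-mono-≤ (f≤g zero) (sum-mono (f≤g ∘ suc))

-- The passage from a tight degree count to the adjacency of each single vertex; the adjacencies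
-- claimed in (B2) and (B3) are obtained through it.
sum-squeeze : ∀ {n} {f g : Fin n → ℕ} → (∀ i → f i ≤ g i) → sum g ≤ sum f → ∀ i → f i ≡ g i
sum-squeeze {suc n} {f} {g} f≤g le = λ
  { zero    → ≤-antisym (f≤g zero) (+-cancelʳ-≤ (sum (g ∘ suc)) _ _
                (≤-trans le (+-monoʳ-≤ (f zero) (sum-mono (f≤g ∘ suc)))))
  ; (suc i) → sum-squeeze (f≤g ∘ suc) (+-cancelˡ-≤ (g zero) _ _
                (≤-trans le (+-monoˡ-≤ _ (f≤g zero)))) i }

sum≥one : ∀ {n} (f : Fin n → ℕ) i → f i ≤ sum f
sum≥one f zero    = m≤m+n _ _
sum≥one f (suc i) = ≤-trans (sum≥one (f ∘ suc) i) (m≤n+m _ _)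

sum≥two : ∀ {n} (f : Fin n → ℕ) i j → i ≢ j → f i + f j ≤ sum f
sum≥two f zero    zero    i≢j = contradiction refl i≢j
sum≥two f zero    (suc j) i≢j = +-monoʳ-≤ (f zero) (sum≥one (f ∘ suc) j)
sum≥two f (suc i) zero    i≢j = subst (_≤ sum f) (+-comm (f zero) _) (+-monoʳ-≤ (f zero) (sum≥one (f ∘ suc) i))
sum≥two f (suc i) (suc j) i≢j = ≤-trans (sum≥two (f ∘ suc) i j (i≢j ∘ cong suc)) (m≤n+m _ _)

δ : ∀ {n} → Fin n → Fin n → ℕ
δ w v = ⟦ does (w ≟ v) ⟧

δ-refl : ∀ {n} (w : Fin n) → δ w w ≡ 1
δ-refl w with w ≟ w
... | yes _  = refl
... | no w≢w = contradiction refl w≢w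

δ-pos : ∀ {n} {w v : Fin n} → 0 < δ w v → w ≡ v
δ-pos {w = w} {v} p with w ≟ v
... | yes eq = eq

δ-≢ : ∀ {n} {w v : Fin n} → w ≢ v → δ w v ≡ 0
δ-≢ {w = w} {v} w≢v with w ≟ v
... | yes eq = contradiction eq w≢v
... | no _   = refl

sum-δ : ∀ {n} (w : Fin n) → sum (δ w) ≡ 1
sum-δ {suc n} zero    = cong suc (sum-zero n)
sum-δ {suc n} (suc w) = trans (sum-cong-≗ step) (sum-δ w)
  where
  step : ∀ v → δ (suc w) (suc v) ≡ δ w v
  step v with w ≟ v
  ... | yes _ = refl
  ... | no  _ = refl

-- Totals over lists and removal of an entry

total : ∀ {A : Set} → (A → ℕ) → List A → ℕ
total f xs = listSum (map f xs)

total-tabulate : ∀ {n} {A : Set} (f : A → ℕ) (g : Fin n → A) → total f (tabulate g) ≡ sum (f ∘ g)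
total-tabulate {zero}  f g = refl
total-tabulate {suc n} f g = cong (f (g zero) +_) (total-tabulate f (g ∘ suc))

total-one : ∀ {A : Set} (xs : List A) → total (λ _ → 1) xs ≡ length xs
total-one []       = refl
total-one (x ∷ xs) = cong suc (total-one xs)

data Pick {A : Set} : List A → A → List A → Set where
  here  : ∀ {x xs} → Pick (x ∷ xs) x xs
  there : ∀ {x y xs ys} → Pick xs x ys → Pick (y ∷ xs) x (y ∷ ys)

-- Counted from zero: `here` is the head, so `1st` brings the second entry to the front.
pattern 1st = there here
pattern 2nd = there (there here)
pattern 3rd = there (there (there here))
pattern 4th = there (there (there (there here)))

total-pick : ∀ {A : Set} {xs ys} {x : A} (f : A → ℕ) → Pick xs x ys → total f xs ≡ f x + total f ys
total-pick f here = refl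
total-pick f (there {x} {y} {xs} {ys} p) =
  trans (cong (f y +_) (total-pick f p)) (solve-swap (f y) (f x) (total f ys))
  where
  solve-swap : ∀ a b c → a + (b + c) ≡ b + (a + c)
  solve-swap = solve-∀

length-pick : ∀ {A : Set} {xs ys} {x : A} → Pick xs x ys → length xs ≡ suc (length ys)
length-pick here      = refl
length-pick (there p) = cong suc (length-pick p)

pick-pos : ∀ {A : Set} (f : A → ℕ) xs → 0 < total f xs → ∃[ x ] ∃[ ys ] Pick xs x ys × 0 < f x
pick-pos f (x ∷ xs) p with pos-+ (f x) p
... | inj₁ q = x , xs , here , q
... | inj₂ q with y , ys , pk , r ← pick-pos f xs q = y , x ∷ ys , there pk , r

-- Coloured walks, their splits, and the search for an exchangeable edge

module Walks {n m : ℕ} (G : Collection m n) where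

  e : Fin m → Fin n → Fin n → ℕ
  e c x y = ⟦ adj (G c) x y ⟧

  e≤1 : ∀ c x y → e c x y ≤ 1
  e≤1 c x y = ⟦⟧≤1 (adj (G c) x y)

  e-sym : ∀ c x y → e c x y ≡ e c y x
  e-sym c x y = cong ⟦_⟧ (sym (G c) x y)

  e-irrefl : ∀ c x → e c x x ≡ 0
  e-irrefl c x = cong ⟦_⟧ (irrefl (G c) x)

  e-edge : ∀ {c x y} → 0 < e c x y → x ~[ G c ] y
  e-edge = ⟦⟧-true _

  deg≡sum : ∀ c x → deg (G c) x ≡ sum (e c x)
  deg≡sum c x = count≡sum (adj (G c) x)

  ~sym : ∀ {c x y} → x ~[ G c ] y → y ~[ G c ] x
  ~sym {c} {x} {y} p = trans (sym (G c) y x) p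

  -- Walks are trees of concatenations and reversals, so that vertex and colour
  -- sums of a rebuilt walk compute.
  data Walk : Fin n → Fin n → Set where
    pt   : ∀ x → Walk x x
    join : ∀ {a b b′ z} → Walk a b → ∀ c → b ~[ G c ] b′ → Walk b′ z → Walk a z
    rev  : ∀ {a b} → Walk a b → Walk b a

  Σv : ∀ {a b} → Walk a b → (Fin n → ℕ) → ℕ
  Σv (pt x)         f = f x
  Σv (join A _ _ B) f = Σv A f + Σv B f
  Σv (rev A)        f = Σv A f

  Σc : ∀ {a b} → Walk a b → (Fin m → ℕ) → ℕ
  Σc (pt x)         f = 0
  Σc (join A c _ B) f = Σc A f + (f c + Σc B f)
  Σc (rev A)        f = Σc A f

  edges : ∀ {a b} → Walk a b → ℕ
  edges W = Σc W (λ _ → 1)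

  Σv-one : ∀ {a b} (W : Walk a b) → Σv W (λ _ → 1) ≡ suc (edges W)
  Σv-one (pt x) = refl
  Σv-one (join A c _ B) rewrite Σv-one A | Σv-one B = refl
  Σv-one (rev A) = Σv-one A

  Σv-start : ∀ {a b} (W : Walk a b) f → f a ≤ Σv W f
  Σv-end   : ∀ {a b} (W : Walk a b) f → f b ≤ Σv W f
  Σv-start (pt x)         f = ≤-refl
  Σv-start (join A _ _ B) f = ≤-trans (Σv-start A f) (m≤m+n _ _)
  Σv-start (rev A)        f = Σv-end A f
  Σv-end   (pt x)         f = ≤-refl
  Σv-end   (join A _ _ B) f = ≤-trans (Σv-end B f) (m≤n+m _ _)
  Σv-end   (rev A)        f = Σv-start A f

  Σv-cong : ∀ {a b} (W : Walk a b) {f g} → (∀ w → 0 < Σv W (δ w) → f w ≡ g w) → Σv W f ≡ Σv W g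
  Σv-cong (pt x)         h = h x (subst (0 <_) (≡sym (δ-refl x)) z<s)
  Σv-cong (join A _ _ B) h = cong₂ _+_ (Σv-cong A λ w p → h w (pos-+ˡ _ p))
                                       (Σv-cong B λ w p → h w (pos-+ʳ (Σv A (δ w)) p))
  Σv-cong (rev A)        h = Σv-cong A h

  -- Only the sums of W and join A c ab B are compared: the order within W is forgotten.
  record Split {s x} (W : Walk s x) : Set where
    constructor split
    field
      {a b} : Fin n
      A     : Walk s a
      c     : Fin m
      ab    : a ~[ G c ] b
      B     : Walk b x
      veq   : ∀ f → Σv W f ≡ Σv A f + Σv B f
      ceq   : ∀ f → Σc W f ≡ Σc A f + (f c + Σc B f)

  joint : ∀ {s a b x} (A : Walk s a) c (p : a ~[ G c ] b) (B : Walk b x) → Split (join A c p B)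
  joint A c p B = split A c p B (λ _ → refl) (λ _ → refl)

  private
    shift₁ : ∀ c a d b e → a + (d + b) + (c + e) ≡ a + (d + (b + (c + e)))
    shift₁ = solve-∀
    shift₂ : ∀ c a d b e → e + (c + (a + (d + b))) ≡ (e + (c + a)) + (d + b)
    shift₂ = solve-∀
    shift₃ : ∀ a d b → a + (d + b) ≡ b + (d + a)
    shift₃ = solve-∀

  inˡ : ∀ {s a b x} {A : Walk s a} c (p : a ~[ G c ] b) (B : Walk b x) → Split A → Split (join A c p B)
  inˡ c p B (split A₁ d q A₂ veq ceq) = split A₁ d q (join A₂ c p B)
    (λ f → trans (cong (_+ Σv B f) (veq f)) (+-assoc (Σv A₁ f) _ _))
    (λ f → trans (cong (_+ (f c + Σc B f)) (ceq f)) (shift₁ (f c) (Σc A₁ f) (f d) (Σc A₂ f) (Σc B f)))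

  inʳ : ∀ {s a b x} (A : Walk s a) c (p : a ~[ G c ] b) {B : Walk b x} → Split B → Split (join A c p B)
  inʳ A c p (split B₁ d q B₂ veq ceq) = split (join A c p B₁) d q B₂
    (λ f → trans (cong (Σv A f +_) (veq f)) (≡sym (+-assoc (Σv A f) _ _)))
    (λ f → trans (cong (λ z → Σc A f + (f c + z)) (ceq f)) (shift₂ (f c) (Σc B₁ f) (f d) (Σc B₂ f) (Σc A f)))

  flipSplit : ∀ {s x} {W : Walk s x} → Split W → Split (rev W)
  flipSplit (split A c p B veq ceq) = split (rev B) c (~sym p) (rev A)
    (λ f → trans (veq f) (+-comm (Σv A f) _))
    (λ f → trans (ceq f) (shift₃ (Σc A f) (f c) (Σc B f)))

  -- Every vertex but the last is the tail of an edge, every vertex but the first a head; `rev`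
  -- exchanges the two, hence the mutual recursion. `g` is arbitrary so that it can mark one vertex
  -- (`δ w`) or the neighbours of a vertex (`e β y`).
  locateʳ : ∀ {s x} (W : Walk s x) g → 0 < Σv W g → 0 < g x ⊎ Σ (Split W) λ S → 0 < g (Split.a S)
  locateˡ : ∀ {s x} (W : Walk s x) g → 0 < Σv W g → 0 < g s ⊎ Σ (Split W) λ S → 0 < g (Split.b S)
  locateʳ (pt x) g p = inj₁ p
  locateʳ (join A c q B) g p with pos-+ (Σv A g) p
  ... | inj₁ pA = inj₂ (case locateʳ A g pA of λ
        { (inj₁ r) → joint A c q B , r ; (inj₂ (S , r)) → inˡ c q B S , r })
  ... | inj₂ pB = case locateʳ B g pB of λ
        { (inj₁ r) → inj₁ r ; (inj₂ (S , r)) → inj₂ (inʳ A c q S , r) }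
  locateʳ (rev A) g p = case locateˡ A g p of λ
        { (inj₁ r) → inj₁ r ; (inj₂ (S , r)) → inj₂ (flipSplit S , r) }
  locateˡ (pt x) g p = inj₁ p
  locateˡ (join A c q B) g p with pos-+ (Σv A g) p
  ... | inj₁ pA = case locateˡ A g pA of λ
        { (inj₁ r) → inj₁ r ; (inj₂ (S , r)) → inj₂ (inˡ c q B S , r) }
  ... | inj₂ pB = inj₂ (case locateˡ B g pB of λ
        { (inj₁ r) → joint A c q B , r ; (inj₂ (S , r)) → inʳ A c q S , r })
  locateˡ (rev A) g p = case locateʳ A g p of λ
        { (inj₁ r) → inj₁ r ; (inj₂ (S , r)) → inj₂ (flipSplit S , r) }

  locateᶜ : ∀ {s x} (W : Walk s x) g → 0 < Σc W g → Σ (Split W) λ S → 0 < g (Split.c S)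
  locateᶜ (join A c q B) g p with pos-+ (Σc A g) p
  ... | inj₁ pA = case locateᶜ A g pA of λ { (S , r) → inˡ c q B S , r }
  ... | inj₂ pB with pos-+ (g c) pB
  ...   | inj₁ r  = joint A c q B , r
  ...   | inj₂ pB′ = case locateᶜ B g pB′ of λ { (S , r) → inʳ A c q S , r }
  locateᶜ (rev A) g p = case locateᶜ A g p of λ { (S , r) → flipSplit S , r }

  -- For `f = e α x` and `h = e β y` this is an edge ab that can be exchanged for xa and yb.
  Conflict : ∀ {s x} → Walk s x → (f h : Fin n → ℕ) → Set
  Conflict W f h = Σ (Split W) λ S → 2 ≤ f (Split.a S) + h (Split.b S)

  private
    glue : ∀ p₁ q₁ e₁ fb hs p₂ q₂ e₂ fx hb → p₁ + q₁ ≤ e₁ + (fb + hs) → p₂ + q₂ ≤ e₂ + (fx + hb) →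
           fb + hb ≤ 1 → (p₁ + p₂) + (q₁ + q₂) ≤ (e₁ + (1 + e₂)) + (fx + hs)
    glue p₁ q₁ e₁ fb hs p₂ q₂ e₂ fx hb h₁ h₂ h₃ =
      linear (fb + hb) (+-mono-≤ (+-mono-≤ h₁ h₂) h₃)
        (solve (p₁ ∷ q₁ ∷ p₂ ∷ q₂ ∷ fb ∷ hb ∷ []))
        (solve (e₁ ∷ e₂ ∷ fb ∷ hb ∷ fx ∷ hs ∷ []))

  -- Summing f a + h b over the edges (a , b) counts f at every vertex but the last
  -- and h at every vertex but the first.
  search : ∀ {s x} (W : Walk s x) f h →
           Conflict W f h ⊎ Σv W f + Σv W h ≤ edges W + (f x + h s)
  search (pt x) f h = inj₂ ≤-refl
  search (join {s} {b} {b′} {x} A c p B) f h with search A f h | search B f h | f b + h b′ ≤? 1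
  ... | inj₁ (S , q) | _ | _ = inj₁ (inˡ c p B S , q)
  ... | inj₂ _ | inj₁ (S , q) | _ = inj₁ (inʳ A c p S , q)
  ... | inj₂ _ | inj₂ _ | no ≰1 = inj₁ (joint A c p B , ≰⇒> ≰1)
  ... | inj₂ hA | inj₂ hB | yes ≤1 = inj₂
    (glue (Σv A f) (Σv A h) (edges A) (f b) (h s) (Σv B f) (Σv B h) (edges B) (f x) (h b′) hA hB ≤1)
  search (rev {s} {x} A) f h with search A h f
  ... | inj₁ (S , q) = inj₁ (flipSplit S , subst (2 ≤_) (+-comm (h (Split.a S)) _) q)
  ... | inj₂ q = inj₂ (subst₂′ (+-comm (Σv A h) _) (cong (edges A +_) (+-comm (h x) _)) q)
    where
    subst₂′ : ∀ {a b c d} → a ≡ b → c ≡ d → a ≤ c → b ≤ d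
    subst₂′ refl refl r = r

-- Rainbow linear forests and exchanges

module Forests {n : ℕ} (G : Collection n n) where

  open Walks G public

  Tree : Set
  Tree = Σ (Fin n) λ a → Σ (Fin n) λ b → Walk a b

  pattern ⟨_⟩ W = (_ , _ , W)

  treeV treeC : (Fin n → ℕ) → Tree → ℕ
  treeV f ⟨ W ⟩ = Σv W f
  treeC f ⟨ W ⟩ = Σc W f

  Vs Cs : List Tree → (Fin n → ℕ) → ℕ
  Vs L f = total (treeV f) L
  Cs L f = total (treeC f) L

  -- The walks of L partition the vertices outside O and are coloured bijectively
  -- by the colours outside Q; both multiset equalities are stated through sums.
  record Forest (O : List (Fin n)) (L : List Tree) (Q : List (Fin n)) : Set where
    constructor forest
    field
      cov : ∀ f → Vs L f + total f O ≡ sum f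
      col : ∀ f → Cs L f + total f Q ≡ sum f
  open Forest public

  private
    cut-eq : ∀ a b c x y → a + (b + x) + (c + y) ≡ a + (c + b) + x + y
    cut-eq = solve-∀
    grow-eq : ∀ a x y → (a + x) + y ≡ x + (a + y)
    grow-eq = solve-∀

  cut : ∀ {O L Q s x} {W : Walk s x} → Forest O (⟨ W ⟩ ∷ L) Q → (S : Split W) →
        Forest O (⟨ Split.A S ⟩ ∷ ⟨ Split.B S ⟩ ∷ L) (Split.c S ∷ Q)
  cut {O} {L} {Q} F (split A c p B veq ceq) = forest
    (λ f → trans (cong (_+ total f O)
                   (trans (≡sym (+-assoc (Σv A f) _ _)) (cong (_+ Vs L f) (≡sym (veq f)))))
                 (cov F f))
    (λ f → trans (cut-eq (Σc A f) (Σc B f) (f c) (Cs L f) (total f Q))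
                 (trans (cong (λ z → z + Cs L f + total f Q) (≡sym (ceq f))) (col F f)))

  link : ∀ {O L Q a b b′ z c} {A : Walk a b} {B : Walk b′ z} →
         Forest O (⟨ A ⟩ ∷ ⟨ B ⟩ ∷ L) (c ∷ Q) → (p : b ~[ G c ] b′) → Forest O (⟨ join A c p B ⟩ ∷ L) Q
  link {O} {L} {Q} {c = c} {A} {B} F p = forest
    (λ f → trans (cong (_+ total f O) (+-assoc (Σv A f) _ _)) (cov F f))
    (λ f → trans (≡sym (cut-eq (Σc A f) (Σc B f) (f c) (Cs L f) (total f Q))) (col F f))

  flip : ∀ {O L Q a b} {A : Walk a b} → Forest O (⟨ A ⟩ ∷ L) Q → Forest O (⟨ rev A ⟩ ∷ L) Q
  flip (forest cov col) = forest cov col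

  grow : ∀ {O L Q w} → Forest (w ∷ O) L Q → Forest O (⟨ pt w ⟩ ∷ L) Q
  grow {O} {L} {Q} {w} F = forest (λ f → trans (grow-eq (f w) (Vs L f) (total f O)) (cov F f)) (col F)

  pullᵂ : ∀ {O L L′ Q W} → Pick L W L′ → Forest O L Q → Forest O (W ∷ L′) Q
  pullᵂ {O} {L} {L′} {Q} p F = forest
    (λ f → trans (cong (_+ total f O) (≡sym (total-pick (treeV f) p))) (cov F f))
    (λ f → trans (cong (_+ total f Q) (≡sym (total-pick (treeC f) p))) (col F f))

  pullᶜ : ∀ {O L Q Q′ c} → Pick Q c Q′ → Forest O L Q → Forest O L (c ∷ Q′)
  pullᶜ {O} {L} p F = forest (cov F) (λ f → trans (cong (Cs L f +_) (≡sym (total-pick f p))) (col F f))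

  Vs-one : ∀ L → Vs L (λ _ → 1) ≡ length L + Cs L (λ _ → 1)
  Vs-one []          = refl
  Vs-one (⟨ W ⟩ ∷ L) rewrite Σv-one W | Vs-one L = cong suc (swap (edges W) (length L) _)
    where
    swap : ∀ a b c → a + (b + c) ≡ b + (a + c)
    swap = solve-∀

  edgeTotal : List Tree → ℕ
  edgeTotal L = Cs L (λ _ → 1)

  order : ∀ {O L Q} → Forest O L Q → length L + edgeTotal L + length O ≡ n
  order {O} {L} F = trans (≡sym (cong₂ _+_ (Vs-one L) (total-one O)))
                          (trans (cov F (λ _ → 1)) (sum-one n))

  spares : ∀ {O L Q} → Forest O L Q → length Q ≡ length L + length O
  spares {O} {L} {Q} F = +-cancelˡ-≡ (edgeTotal L) _ _ (begin
    edgeTotal L + length Q                ≡⟨ cong (edgeTotal L +_) (total-one Q) ⟨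
    edgeTotal L + total (λ _ → 1) Q       ≡⟨ col F (λ _ → 1) ⟩
    sum {n} (λ _ → 1)                     ≡⟨ sum-one n ⟩
    n                                     ≡⟨ order F ⟨
    length L + edgeTotal L + length O     ≡⟨ rearr (edgeTotal L) (length L) (length O) ⟩
    edgeTotal L + (length L + length O)   ∎)
    where
    open ≡-Reasoning
    rearr : ∀ a b c → b + a + c ≡ a + (b + c)
    rearr = solve-∀

  apart : ∀ {O L Q s x y t} {W₁ : Walk s x} {W₂ : Walk y t} → Forest O (⟨ W₁ ⟩ ∷ ⟨ W₂ ⟩ ∷ L) Q → x ≢ y
  apart {O} {L} {x = x} {W₁ = W₁} {W₂} F refl = <-irrefl refl (begin-strict
    1                                                     <⟨ ≤-refl ⟩
    1 + 1                                                 ≤⟨ +-mono-≤ (one (Σv-end W₁ (δ x))) (one (Σv-start W₂ (δ x))) ⟩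
    Σv W₁ (δ x) + Σv W₂ (δ x)                             ≤⟨ +-monoʳ-≤ (Σv W₁ (δ x)) (m≤m+n _ (Vs L (δ x))) ⟩
    Σv W₁ (δ x) + (Σv W₂ (δ x) + Vs L (δ x))              ≤⟨ m≤m+n _ (total (δ x) O) ⟩
    Σv W₁ (δ x) + (Σv W₂ (δ x) + Vs L (δ x)) + total (δ x) O ≡⟨ cov F (δ x) ⟩
    sum (δ x)                                             ≡⟨ sum-δ x ⟩
    1                                                     ∎)
    where
    open ≤-Reasoning
    one : ∀ {k} → δ x x ≤ k → 1 ≤ k
    one = subst (_≤ _) (δ-refl x)

  merge : ∀ {O L Q s x y t c} {W₁ : Walk s x} {W₂ : Walk y t} →
          Forest O (⟨ W₁ ⟩ ∷ ⟨ W₂ ⟩ ∷ L) (c ∷ Q) → (p : 0 < e c x y) →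
          Forest O (⟨ join W₁ c (e-edge p) W₂ ⟩ ∷ L) Q
  merge F p = link F (e-edge p)

  e-flip : ∀ {c x y} → 0 < e c x y → 0 < e c y x
  e-flip {c} {x} {y} = subst (0 <_) (e-sym c x y)

  e-conflict : ∀ {α x a β y b} → 2 ≤ e α x a + e β y b → 0 < e α x a × 0 < e β y b
  e-conflict {α} {x} {a} {β} {y} {b} = ≤-both-1 (e≤1 α x a) (e≤1 β y b)

  -- In each of the next three lemmas the edge ab of the split is exchanged for xa and yb.
  cross₁ : ∀ {O L Q s x y t α β} {W₁ : Walk s x} {W₂ : Walk y t} →
           Forest O (⟨ W₁ ⟩ ∷ ⟨ W₂ ⟩ ∷ L) (α ∷ β ∷ Q) → (S : Split W₁) →
           0 < e α x (Split.a S) → 0 < e β y (Split.b S) →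
           Σ (Walk s t) λ W → Forest O (⟨ W ⟩ ∷ L) (Split.c S ∷ Q)
  cross₁ F S p q =
    _ , merge (pullᶜ 1st (merge (pullᶜ 1st (pullᵂ 1st (flip (pullᵂ 1st (cut F S))))) (e-flip p))) (e-flip q)

  cross₂ : ∀ {O L Q s x y t α β} {W₁ : Walk s x} {W₂ : Walk y t} →
           Forest O (⟨ W₁ ⟩ ∷ ⟨ W₂ ⟩ ∷ L) (α ∷ β ∷ Q) → (S : Split W₂) →
           0 < e α x (Split.a S) → 0 < e β y (Split.b S) →
           Σ (Walk s t) λ W → Forest O (⟨ W ⟩ ∷ L) (Split.c S ∷ Q)
  cross₂ F S p q =
    _ , merge (pullᶜ 1st (merge (pullᶜ 1st (pullᵂ 2nd (flip (cut (pullᵂ 1st F) S)))) p)) q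

  cross₃ : ∀ {O L Q s x y t z w α β} {W₁ : Walk s x} {W₂ : Walk y t} {W : Walk z w} →
           Forest O (⟨ W ⟩ ∷ ⟨ W₁ ⟩ ∷ ⟨ W₂ ⟩ ∷ L) (α ∷ β ∷ Q) → (S : Split W) →
           0 < e α x (Split.a S) → 0 < e β y (Split.b S) →
           ∃[ T ] ∃[ T′ ] Forest O (T ∷ T′ ∷ L) (Split.c S ∷ Q)
  cross₃ F S p q =
    _ , _ , merge (pullᶜ 1st (pullᵂ 1st (pullᵂ 2nd (flip (pullᵂ 2nd
            (merge (pullᶜ 1st (pullᵂ 2nd (flip (cut F S)))) p)))))) q

  -- Concerns the walks other than the two that end in `x` and `y`. `atEnd` and `atStart` are the
  -- boundary terms of `search`: if one is positive, `x` or `y` sees an end of a third walk, and the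
  -- two walks join directly.
  data Event (f h : Fin n → ℕ) (L : List Tree) : Set where
    conflict : ∀ {a b} {W : Walk a b} {R} → Pick L ⟨ W ⟩ R → Conflict W f h → Event f h L
    atEnd    : ∀ {a b} {W : Walk a b} {R} → Pick L ⟨ W ⟩ R → 0 < f b → Event f h L
    atStart  : ∀ {a b} {W : Walk a b} {R} → Pick L ⟨ W ⟩ R → 0 < h a → Event f h L

  thereᴱ : ∀ {f h W L} → Event f h L → Event f h (W ∷ L)
  thereᴱ (conflict p c) = conflict (there p) c
  thereᴱ (atEnd p c)    = atEnd (there p) c
  thereᴱ (atStart p c)  = atStart (there p) c

  private
    drop-ends : ∀ {a} k {fx hs} → fx ≡ 0 → hs ≡ 0 → a ≤ k + (fx + hs) → a ≤ k
    drop-ends k refl refl h = ≤-trans h (≤-reflexive (+-identityʳ k))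
    add₂ : ∀ p q r s → (p + r) + (q + s) ≡ (p + q) + (r + s)
    add₂ = solve-∀
    add₃ : ∀ p q k p′ q′ r s → (p + (p′ + r)) + (q + (q′ + s)) + k ≡ (p + q + k) + (p′ + q′ + (r + s))
    add₃ = solve-∀

  searchᶠ : ∀ f h L → Event f h L ⊎ Vs L f + Vs L h ≤ edgeTotal L
  searchᶠ f h [] = inj₂ z≤n
  searchᶠ f h ((a , b , W) ∷ L) with searchᶠ f h L | search W f h | zero⊎pos (f b) | zero⊎pos (h a)
  ... | inj₁ E | _ | _ | _ = inj₁ (thereᴱ E)
  ... | inj₂ _ | inj₁ C | _ | _ = inj₁ (conflict here C)
  ... | inj₂ _ | inj₂ _ | inj₂ p | _ = inj₁ (atEnd here p)
  ... | inj₂ _ | inj₂ _ | inj₁ _ | inj₂ p = inj₁ (atStart here p)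
  ... | inj₂ h₂ | inj₂ h₁ | inj₁ fb | inj₁ ha =
    inj₂ (≤-trans (≤-reflexive (add₂ (Σv W f) (Σv W h) _ _)) (+-mono-≤ (drop-ends (edges W) fb ha h₁) h₂))

  Smaller : List (Fin n) → ℕ → Set
  Smaller O l = ∃[ L ] ∃[ Q ] Forest O L Q × length L ≡ l

  -- All boundary terms vanish: `x` and `y` carry no loops, and an edge from `y` to `s` or from `x`
  -- to `t` merges the walks. The search on `W₁` is a premise so that either the plain version or
  -- the one with slack `k` can be supplied.
  bound : ∀ {O L Q s x y t α β} {W₁ : Walk s x} {W₂ : Walk y t} →
          Forest O (⟨ W₁ ⟩ ∷ ⟨ W₂ ⟩ ∷ L) (α ∷ β ∷ Q) → ∀ k →
          Conflict W₁ (e α x) (e β y) ⊎ Σv W₁ (e α x) + Σv W₁ (e β y) + k ≤ edges W₁ + (e α x x + e β y s) →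
          Smaller O (suc (length L)) ⊎
          Vs (⟨ W₁ ⟩ ∷ ⟨ W₂ ⟩ ∷ L) (e α x) + Vs (⟨ W₁ ⟩ ∷ ⟨ W₂ ⟩ ∷ L) (e β y) + k
            ≤ edgeTotal (⟨ W₁ ⟩ ∷ ⟨ W₂ ⟩ ∷ L)
  bound {L = L} {s = s} {x} {y} {t} {α} {β} {W₁} {W₂} F k h₁
    with h₁ | search W₂ (e α x) (e β y) | searchᶠ (e α x) (e β y) L
       | zero⊎pos (e β y s) | zero⊎pos (e α x t)
  ... | inj₁ (S , c) | _ | _ | _ | _ =
    let p , q = e-conflict c in inj₁ (_ , _ , proj₂ (cross₁ F S p q) , refl)
  ... | inj₂ _ | inj₁ (S , c) | _ | _ | _ =
    let p , q = e-conflict c in inj₁ (_ , _ , proj₂ (cross₂ F S p q) , refl)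
  ... | inj₂ _ | inj₂ _ | inj₁ (conflict pk (S , c)) | _ | _ =
    let p , q = e-conflict c
        _ , _ , F′ = cross₃ (pullᵂ (there (there pk)) F) S p q
    in inj₁ (_ , _ , F′ , cong suc (≡sym (length-pick pk)))
  ... | inj₂ _ | inj₂ _ | inj₁ (atEnd pk p) | _ | _ =
    inj₁ (_ , _ , merge (pullᵂ 1st (flip (pullᵂ (there (there pk)) F))) p , cong suc (≡sym (length-pick pk)))
  ... | inj₂ _ | inj₂ _ | inj₁ (atStart pk p) | _ | _ =
    inj₁ (_ , _ , merge (pullᶜ 1st (flip (pullᵂ 2nd (pullᵂ (there (there pk)) F)))) p
         , cong suc (≡sym (length-pick pk)))
  ... | inj₂ _ | inj₂ _ | inj₂ _ | inj₂ p | _ = inj₁ (_ , _ , merge (pullᶜ 1st (flip F)) (e-flip p) , refl)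
  ... | inj₂ _ | inj₂ _ | inj₂ _ | inj₁ _ | inj₂ p = inj₁ (_ , _ , merge (pullᵂ 1st (flip (pullᵂ 1st F))) p , refl)
  ... | inj₂ b₁ | inj₂ b₂ | inj₂ b₃ | inj₁ hs | inj₁ ft = inj₂
    (≤-trans
       (≤-reflexive (add₃ (Σv W₁ (e α x)) (Σv W₁ (e β y)) k (Σv W₂ (e α x)) (Σv W₂ (e β y)) _ _))
       (+-mono-≤ (drop-ends (edges W₁) (e-irrefl α x) hs b₁)
                 (+-mono-≤ (drop-ends (edges W₂) ft (e-irrefl β y) b₂) b₃)))

  search₀ : ∀ {s x} (W : Walk s x) f h →
            Conflict W f h ⊎ Σv W f + Σv W h + 0 ≤ edges W + (f x + h s)
  search₀ W f h = [ inj₁ , (λ le → inj₂ (≤-trans (≤-reflexive (+-identityʳ _)) le)) ]′ (search W f h)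

-- The Ore condition and the reduction to at most two walks

module Ore {n : ℕ} (G : Collection n n) (σ : ∀ i → σ₂≥ (G i) n) where

  open Forests G public

  e≡0 : ∀ {c x y} → e c x y ≡ 0 → ¬ x ~[ G c ] y
  e≡0 {c} {x} {y} p q with adj (G c) x y
  e≡0 () refl | true

  deg-bound : ∀ {O L Q} → Forest O L Q → ∀ c x → deg (G c) x ≤ Vs L (e c x) + length O
  deg-bound {O} {L} F c x = begin
    deg (G c) x                       ≡⟨ deg≡sum c x ⟩
    sum (e c x)                       ≡⟨ cov F (e c x) ⟨
    Vs L (e c x) + total (e c x) O    ≤⟨ +-monoʳ-≤ (Vs L (e c x)) (total≤ O) ⟩
    Vs L (e c x) + length O           ∎
    where
    open ≤-Reasoning
    total≤ : ∀ O → total (e c x) O ≤ length O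
    total≤ []      = z≤n
    total≤ (w ∷ O) = +-mono-≤ (e≤1 c x w) (total≤ O)

  private
    regroup : ∀ a b c d o → ((a + o) + (d + o)) + ((c + o) + (b + o)) ≡ (a + b) + (c + d) + (o + o + (o + o))
    regroup = solve-∀

  ore : ∀ {O L Q x y α β} → Forest O L Q → x ≢ y → e α x y ≡ 0 → e β x y ≡ 0 →
        n + n ≤ (Vs L (e α x) + Vs L (e β y)) + (Vs L (e β x) + Vs L (e α y))
                + (length O + length O + (length O + length O))
  ore {O} {L} {x = x} {y} {α} {β} F x≢y p q = begin
    n + n
      ≤⟨ +-mono-≤ (σ α x y x≢y (e≡0 p)) (σ β x y x≢y (e≡0 q)) ⟩
    (deg (G α) x + deg (G α) y) + (deg (G β) x + deg (G β) y)
      ≤⟨ +-mono-≤ (+-mono-≤ (d α x) (d α y)) (+-mono-≤ (d β x) (d β y)) ⟩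
    ((Vs L (e α x) + o) + (Vs L (e α y) + o)) + ((Vs L (e β x) + o) + (Vs L (e β y) + o))
      ≡⟨ regroup (Vs L (e α x)) (Vs L (e β y)) (Vs L (e β x)) (Vs L (e α y)) o ⟩
    (Vs L (e α x) + Vs L (e β y)) + (Vs L (e β x) + Vs L (e α y)) + (o + o + (o + o)) ∎
    where
    open ≤-Reasoning
    o = length O
    d = deg-bound F

  private
    few₁ : ∀ D₁ D₂ E o l k → (D₁ + D₂ + (E + E) + (o + o)) + (l + l + k)
           ≡ ((l + E + o) + (l + E + o)) + ((D₁ + k) + D₂)
    few₁ = solve-∀
    few₂ : ∀ D₁ D₂ E o κ₁ κ₂ → (D₁ + D₂ + (o + o + (o + o))) + ((E + κ₁) + (E + κ₂))
           ≡ (D₁ + D₂ + (E + E) + (o + o)) + (o + o + (κ₁ + κ₂))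
    few₂ = solve-∀

  -- `k` is a deficit found on some edge, and `κ₁`, `κ₂` are boundary terms that could not be
  -- excluded. With all three zero there are at most as many walks as deleted vertices.
  few-walks : ∀ {O L Q x y α β} → Forest O L Q → x ≢ y → e α x y ≡ 0 → e β x y ≡ 0 → ∀ k κ₁ κ₂ →
              Vs L (e α x) + Vs L (e β y) + k ≤ edgeTotal L + κ₁ →
              Vs L (e β x) + Vs L (e α y) ≤ edgeTotal L + κ₂ →
              length L + length L + k ≤ length O + length O + (κ₁ + κ₂)
  few-walks {O} {L} {x = x} {y} {α} {β} F x≢y p q k κ₁ κ₂ h₁ h₂ =
    linear (D₁ + D₂ + (E + E) + (o + o))
      (+-mono-≤ (subst (λ z → z + z ≤ D₁ + D₂ + (o + o + (o + o))) (≡sym (order F)) (ore F x≢y p q))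
                (+-mono-≤ h₁ h₂))
      (few₁ D₁ D₂ E o (length L) k) (few₂ D₁ D₂ E o κ₁ κ₂)
    where
    E = edgeTotal L
    o = length O
    D₁ = Vs L (e α x) + Vs L (e β y)
    D₂ = Vs L (e β x) + Vs L (e α y)

  merge-step : ∀ {O L Q T₁ T₂ T₃ α β} → length O ≡ 2 → Forest O (T₁ ∷ T₂ ∷ T₃ ∷ L) (α ∷ β ∷ Q) →
               Smaller O (suc (suc (length L)))
  merge-step {L = L} {T₁ = s , x , W₁} {y , t , W₂} {T₃} {α} {β} o F
    with zero⊎pos (e α x y) | zero⊎pos (e β x y)
       | bound F 0 (search₀ W₁ _ _) | bound (pullᶜ 1st F) 0 (search₀ W₁ _ _)
  ... | inj₂ p | _ | _ | _ = _ , _ , merge F p , refl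
  ... | inj₁ _ | inj₂ p | _ | _ = _ , _ , merge (pullᶜ 1st F) p , refl
  ... | inj₁ _ | inj₁ _ | inj₁ S | _ = S
  ... | inj₁ _ | inj₁ _ | inj₂ _ | inj₁ S = S
  -- Three or more walks make the left side at least 6, while two deleted vertices make the right
  -- side 4.
  ... | inj₁ p | inj₁ q | inj₂ h₁ | inj₂ h₂ =
    contradiction (few-walks F (apart F) p q 0 0 0 (pad h₁) (≤-trans (m≤m+n _ 0) (pad {b = edgeTotal (⟨ W₁ ⟩ ∷ ⟨ W₂ ⟩ ∷ T₃ ∷ L)} h₂))) λ le →
      <⇒≱ (six (length L)) (subst (λ k → _ ≤ k + k + 0) o le)
    where
    pad : ∀ {a b} → a ≤ b → a ≤ b + 0
    pad {b = b} h = ≤-trans h (m≤m+n b 0)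
    six : ∀ l → 4 < suc (suc (suc l)) + suc (suc (suc l)) + 0
    six l = subst (4 <_) (≡sym (shape l)) (s≤s (s≤s (s≤s (s≤s (s≤s z≤n)))))
      where
      shape : ∀ l → suc (suc (suc l)) + suc (suc (suc l)) + 0 ≡ 6 + (l + l)
      shape = solve-∀

  reduce : ∀ {O} → length O ≡ 2 → ∀ l {L Q} → Forest O L Q → length L ≡ l →
           ∃[ L′ ] ∃[ Q′ ] Forest O L′ Q′ × length L′ ≤ 2
  reduce o l {[]} F _ = _ , _ , F , z≤n
  reduce o l {_ ∷ []} F _ = _ , _ , F , s≤s z≤n
  reduce o l {_ ∷ _ ∷ []} F _ = _ , _ , F , s≤s (s≤s z≤n)
  reduce o (suc l) {_ ∷ _ ∷ _ ∷ L} {α ∷ β ∷ Q} F len =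
    let _ , _ , F′ , eq = merge-step o F in reduce o l F′ (trans eq (cong pred len))
  reduce o l {_ ∷ _ ∷ _ ∷ L} {[]} F _ with () ← spares F
  reduce o l {_ ∷ _ ∷ _ ∷ L} {_ ∷ []} F _ with () ← spares F

  -- Attaching the deleted vertices

  private
    pair-sum : ∀ fw p hw q k → fw ≡ 0 → hw ≡ 0 → p + q ≤ k →
               fw + (p + 0) + (hw + (q + 0)) ≤ k
    pair-sum _ p _ q k refl refl = subst (_≤ k) (≡sym (zeros p q))
      where
      zeros : ∀ p q → p + 0 + (q + 0) ≡ p + q
      zeros = solve-∀

    move-end : ∀ {a} k fz hy → hy ≡ 0 → a ≤ k + (fz + hy) → a ≤ k + 0 + fz
    move-end k fz _ refl h = ≤-trans h (≤-reflexive (shape k fz))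
      where
      shape : ∀ k fz → k + (fz + 0) ≡ k + 0 + fz
      shape = solve-∀

  -- If w cannot be attached to the start of W, then counting at w and y bounds n from above.
  attach : ∀ {O w y z α β Q} {W : Walk y z} → Forest (w ∷ O) (⟨ W ⟩ ∷ []) (α ∷ β ∷ Q) →
           (∀ {Q′} (W′ : Walk w z) → ¬ Forest O (⟨ W′ ⟩ ∷ []) Q′) →
           4 ≤ length O + length O + (e α w z + e β w z)
  attach {O} {w} {y} {z} {α} {β} {Q} {W} F blocked =
    few-walks (grow F) (apart (grow F)) (far (grow F)) (far (pullᶜ 1st (grow F))) 0 (e α w z) (e β w z)
      (≤-trans (≤-reflexive (+-identityʳ _)) (half (grow F))) (half (pullᶜ 1st (grow F)))
    where
    far : ∀ {α Q} → Forest O (⟨ pt w ⟩ ∷ ⟨ W ⟩ ∷ []) (α ∷ Q) → e α w y ≡ 0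
    far {α} F′ with zero⊎pos (e α w y)
    ... | inj₁ eq = eq
    ... | inj₂ p = ⊥-elim (blocked _ (merge F′ p))
    half : ∀ {α β Q} → Forest O (⟨ pt w ⟩ ∷ ⟨ W ⟩ ∷ []) (α ∷ β ∷ Q) →
           Vs (⟨ pt w ⟩ ∷ ⟨ W ⟩ ∷ []) (e α w) + Vs (⟨ pt w ⟩ ∷ ⟨ W ⟩ ∷ []) (e β y)
           ≤ edgeTotal (⟨ pt w ⟩ ∷ ⟨ W ⟩ ∷ []) + e α w z
    half {α} {β} F′ with search W (e α w) (e β y)
    ... | inj₁ (S , c) = let p , q = e-conflict c in ⊥-elim (blocked _ (proj₂ (cross₂ F′ S p q)))
    ... | inj₂ h = pair-sum (e α w w) (Σv W (e α w)) (e β y w) (Σv W (e β y)) _ (e-irrefl α w)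
                     (trans (e-sym β y w) (far (pullᶜ 1st F′)))
                     (move-end (edges W) (e α w z) (e β y y) (e-irrefl β y) h)

  module _ {u v : Fin n} (noPath : ∀ {Q} (W : Walk u v) → ¬ Forest [] (⟨ W ⟩ ∷ []) Q) where

    -- An edge from `v` to the end `u` cannot be used, so the boundary terms at `u` remain. They add
    -- at most 2, and no other deleted vertex is left to make up the required 4.
    no-u-path : ∀ {z Q} (W : Walk z u) → ¬ Forest (v ∷ []) (⟨ W ⟩ ∷ []) Q
    no-u-path {Q = []} W F with () ← spares F
    no-u-path {Q = _ ∷ []} W F with () ← spares F
    no-u-path {Q = α ∷ β ∷ Q} W F =
      contradiction (≤-trans (attach F λ W′ F′ → noPath (rev W′) (flip F′)) (+-mono-≤ (e≤1 α v u) (e≤1 β v u)))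
        λ { (s≤s (s≤s ())) }

    -- Here `u` may be attached to either end, so the boundary terms vanish too, and the remaining
    -- deleted vertex `v` supplies only 2 of the required 4.
    no-inner-path : ∀ {y z Q} (W : Walk y z) → ¬ Forest (u ∷ v ∷ []) (⟨ W ⟩ ∷ []) Q
    no-inner-path {Q = []} W F with () ← spares F
    no-inner-path {Q = _ ∷ []} W F with () ← spares F
    no-inner-path {z = z} {α ∷ β ∷ Q} W F =
      contradiction (subst (4 ≤_) (cong₂ (λ a b → 2 + (a + b)) (far (grow (flip F))) (far (pullᶜ 1st (grow (flip F)))))
                           (attach F blocked))
        λ { (s≤s (s≤s ())) }
      where
      blocked : ∀ {z Q′} (W′ : Walk u z) → ¬ Forest (v ∷ []) (⟨ W′ ⟩ ∷ []) Q′
      blocked W′ F′ = no-u-path (rev W′) (flip F′)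
      far : ∀ {α Q} → Forest (v ∷ []) (⟨ pt u ⟩ ∷ ⟨ rev W ⟩ ∷ []) (α ∷ Q) → e α u z ≡ 0
      far {α} F′ with zero⊎pos (e α u z)
      ... | inj₁ eq = eq
      ... | inj₂ p = ⊥-elim (blocked _ (merge F′ p))

-- Slack, membership and rotations

module Core {n : ℕ} (G : Collection n n) (σ : ∀ i → σ₂≥ (G i) n) where

  open Ore G σ public

  private
    slack-lhs : ∀ p q r s → (p + r) + (q + s) + 1 ≡ (p + q) + (r + s) + 1
    slack-lhs = solve-∀
    slack-rhs : ∀ eA eB hs fx → (eA + (0 + hs)) + (eB + (fx + 0)) + 1 ≡ eA + (1 + eB) + (fx + hs)
    slack-rhs = solve-∀

  unjoin : ∀ {s x} {W : Walk s x} (S : Split W) →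
           Split (join (Split.A S) (Split.c S) (Split.ab S) (Split.B S)) → Split W
  unjoin (split _ _ _ _ veq ceq) (split A c p B veq′ ceq′) =
    split A c p B (λ f → trans (veq f) (veq′ f)) (λ f → trans (ceq f) (ceq′ f))

  -- `search` allows each edge a contribution of 1. The edge of `S` contributes 0, so searching the
  -- two pieces separately gains one.
  search-slack : ∀ {s x} (W : Walk s x) f h (S : Split W) → f (Split.a S) ≡ 0 → h (Split.b S) ≡ 0 →
                 Conflict W f h ⊎ Σv W f + Σv W h + 1 ≤ edges W + (f x + h s)
  search-slack {s} {x} W f h S@(split {a} {b} A c p B veq ceq) fa hb with search A f h | search B f h
  ... | inj₁ (S′ , q) | _ = inj₁ (unjoin S (inˡ c p B S′) , q)
  ... | inj₂ _ | inj₁ (S′ , q) = inj₁ (unjoin S (inʳ A c p S′) , q)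
  ... | inj₂ hA | inj₂ hB = inj₂ (begin
    Σv W f + Σv W h + 1
      ≡⟨ cong₂ (λ i j → i + j + 1) (veq f) (veq h) ⟩
    (Σv A f + Σv B f) + (Σv A h + Σv B h) + 1
      ≡⟨ slack-lhs (Σv A f) (Σv A h) (Σv B f) (Σv B h) ⟩
    (Σv A f + Σv A h) + (Σv B f + Σv B h) + 1
      ≤⟨ +-monoˡ-≤ 1 (+-mono-≤ hA hB) ⟩
    (edges A + (f a + h s)) + (edges B + (f x + h b)) + 1
      ≡⟨ cong₂ (λ i j → (edges A + (i + h s)) + (edges B + (f x + j)) + 1) fa hb ⟩
    (edges A + (0 + h s)) + (edges B + (f x + 0)) + 1
      ≡⟨ slack-rhs (edges A) (edges B) (h s) (f x) ⟩
    edges A + (1 + edges B) + (f x + h s)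
      ≡⟨ cong (_+ (f x + h s)) (ceq (λ _ → 1)) ⟨
    edges W + (f x + h s) ∎)
    where open ≤-Reasoning

  ≤0 : ∀ {a b} → a ≤ b → b ≡ 0 → a ≡ 0
  ≤0 h refl = n≤0⇒n≡0 h

  pos⇒1 : ∀ {c x y} → 0 < e c x y → e c x y ≡ 1
  pos⇒1 {c} {x} {y} p = ≤-antisym (e≤1 c x y) p

  zero-a : ∀ {s x} {W : Walk s x} g → Σv W g ≡ 0 → (S : Split W) → g (Split.a S) ≡ 0
  zero-a g eq S = ≤0 (≤-trans (Σv-end (Split.A S) g) (m≤m+n _ _)) (trans (≡sym (Split.veq S g)) eq)

  zero-b : ∀ {s x} {W : Walk s x} g → Σv W g ≡ 0 → (S : Split W) → g (Split.b S) ≡ 0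
  zero-b g eq S = ≤0 (≤-trans (Σv-start (Split.B S) g) (m≤n+m _ (Σv (Split.A S) g)))
                     (trans (≡sym (Split.veq S g)) eq)

  -- A record, so that `w` and `W` can be inferred from a membership proof.
  record _∈_ {s x} (w : Fin n) (W : Walk s x) : Set where
    constructor mem
    field occurs : 0 < Σv W (δ w)
  open _∈_

  record Inner (O : List (Fin n)) (w : Fin n) : Set where
    constructor inner
    field absent : total (δ w) O ≡ 0
  open Inner

  end-∈ : ∀ {s x} (W : Walk s x) → x ∈ W
  end-∈ {x = x} W = mem (≤-trans (subst (0 <_) (≡sym (δ-refl x)) z<s) (Σv-end W (δ x)))

  start-∈ : ∀ {s x} (W : Walk s x) → s ∈ W
  start-∈ W = mem (occurs (end-∈ (rev W)))

  a-∈ : ∀ {s x} {W : Walk s x} (S : Split W) → Split.a S ∈ W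
  a-∈ S = mem (subst (0 <_) (≡sym (Split.veq S (δ (Split.a S)))) (pos-+ˡ _ (occurs (end-∈ (Split.A S)))))

  b-∈ : ∀ {s x} {W : Walk s x} (S : Split W) → Split.b S ∈ W
  b-∈ S = mem (subst (0 <_) (≡sym (Split.veq S (δ (Split.b S))))
                (pos-+ʳ (Σv (Split.A S) (δ (Split.b S))) (occurs (start-∈ (Split.B S)))))

  at-end : ∀ {s x w} (W : Walk s x) → w ∈ W → w ≡ x ⊎ Σ (Split W) λ S → w ≡ Split.a S
  at-end W p with locateʳ W _ (occurs p)
  ... | inj₁ q = inj₁ (δ-pos q)
  ... | inj₂ (S , q) = inj₂ (S , δ-pos q)

  at-start : ∀ {s x w} (W : Walk s x) → w ∈ W → w ≡ s ⊎ Σ (Split W) λ S → w ≡ Split.b S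
  at-start W p with locateˡ W _ (occurs p)
  ... | inj₁ q = inj₁ (δ-pos q)
  ... | inj₂ (S , q) = inj₂ (S , δ-pos q)

  colour-split : ∀ {s x c} (W : Walk s x) → 0 < Σc W (δ c) → Σ (Split W) λ S → c ≡ Split.c S
  colour-split W p with S , q ← locateᶜ W _ p = S , δ-pos q

  zero-∈ : ∀ {s x w} (W : Walk s x) g → Σv W g ≡ 0 → w ∈ W → g w ≡ 0
  zero-∈ W g eq p with at-end W p
  ... | inj₁ refl = ≤0 (Σv-end W g) eq
  ... | inj₂ (S , refl) = zero-a g eq S

  complement : ∀ {p q r} → p + q ≡ 1 → p + r ≡ 1 → q ≡ r
  complement {p} eq eq′ = +-cancelˡ-≡ p _ _ (trans eq (≡sym eq′))

  one-left : ∀ {p q} → p + q ≡ 1 → q ≡ 0 → 0 < p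
  one-left {suc p} _ _ = z<s
  one-left {zero} () refl

  rotate : ∀ {O L Q s x α} {W : Walk s x} → Forest O (⟨ W ⟩ ∷ L) (α ∷ Q) → (S : Split W) →
           0 < e α x (Split.a S) →
           Σ (Walk s (Split.b S)) λ W′ → Forest O (⟨ W′ ⟩ ∷ L) (Split.c S ∷ Q) × (∀ f → Σv W′ f ≡ Σv W f)
  rotate F S p =
    _ , merge (pullᶜ 1st (pullᵂ 1st (flip (pullᵂ 1st (cut F S))))) (e-flip p) , λ f → ≡sym (Split.veq S f)

  -- Two remaining walks: consequences of equality in the count

  module Near {O : List (Fin n)} (o : length O ≡ 2)
              (noHam : ∀ {y z Q} (W : Walk y z) → ¬ Forest O (⟨ W ⟩ ∷ []) Q) where

    -- The order of the colours matters: `α` belongs to the end `x` and `β` to the end `y`, while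
    -- `γ` and `κ` are in reserve.
    NearPath : ∀ {s x y t} → Walk s x → Walk y t → (α β γ κ : Fin n) → Set
    NearPath W₁ W₂ α β γ κ = Forest O (⟨ W₁ ⟩ ∷ ⟨ W₂ ⟩ ∷ []) (α ∷ β ∷ γ ∷ κ ∷ [])

    module _ {s x y t α β γ κ} {W₁ : Walk s x} {W₂ : Walk y t} (N : NearPath W₁ W₂ α β γ κ) where

      swap : NearPath (rev W₂) (rev W₁) β α γ κ
      swap = pullᶜ 1st (flip (pullᵂ 1st (flip N)))

      flip₂ : NearPath W₁ (rev W₂) α β γ κ
      flip₂ = pullᵂ 1st (flip (pullᵂ 1st N))

      βαγκ : NearPath W₁ W₂ β α γ κ
      βαγκ = pullᶜ 1st N

      αγβκ : NearPath W₁ W₂ α γ β κ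
      αγβκ = pullᶜ 1st (pullᶜ 2nd N)

      γβακ : NearPath W₁ W₂ γ β α κ
      γβακ = pullᶜ 2nd (pullᶜ 1st N)

      αβκγ : NearPath W₁ W₂ α β κ γ
      αβκγ = pullᶜ 2nd (pullᶜ 2nd (pullᶜ 3rd N))

      far : e α x y ≡ 0
      far with zero⊎pos (e α x y)
      ... | inj₁ eq = eq
      ... | inj₂ p  = ⊥-elim (noHam _ (merge N p))

      private
        rest : ∀ {a b r} → 0 < a ⊎ 0 < b → a + (b + 0) + r ≡ 1 → r ≡ 0
        rest {suc a} {b} {r} (inj₁ _) eq = m+n≡0⇒n≡0 (a + (b + 0)) (cong pred eq)
        rest {a} {suc b} {r} (inj₂ _) eq = m+n≡0⇒n≡0 (a + (b + 0))
          (cong pred (trans (cong (_+ r) (≡sym (+-suc a (b + 0)))) eq))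

      ∈-inner₁ : ∀ {w} → w ∈ W₁ → Inner O w
      ∈-inner₁ {w} m = inner (rest (inj₁ (occurs m)) (trans (cov N (δ w)) (sum-δ w)))

      ∈-inner₂ : ∀ {w} → w ∈ W₂ → Inner O w
      ∈-inner₂ {w} m = inner (rest {a = Σv W₁ (δ w)} (inj₂ (occurs m)) (trans (cov N (δ w)) (sum-δ w)))

      inner-∈ : ∀ {w} → Inner O w → w ∈ W₁ ⊎ w ∈ W₂
      inner-∈ {w} i with pos-+ (Σv W₁ (δ w) + (Σv W₂ (δ w) + 0))
                           (subst (0 <_) (≡sym (trans (cov N (δ w)) (sum-δ w))) z<s)
      ... | inj₂ p = contradiction (subst (0 <_) (absent i) p) λ ()
      ... | inj₁ p with pos-+ (Σv W₁ (δ w)) p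
      ...   | inj₁ q = inj₁ (mem q)
      ...   | inj₂ q = inj₂ (mem (subst (0 <_) (+-identityʳ _) q))

      -- With two walks left the count behind merge-step has no slack, so every edge attains it.
      exact : (S : Split W₁) → e α x (Split.a S) + e β y (Split.b S) ≡ 1
      exact S with zero⊎pos (e α x (Split.a S)) | zero⊎pos (e β y (Split.b S))
      ... | inj₂ p | inj₂ q = ⊥-elim (noHam _ (proj₂ (cross₁ N S p q)))
      ... | inj₁ p | inj₂ q rewrite p = pos⇒1 q
      ... | inj₂ p | inj₁ q rewrite q | pos⇒1 p = refl
      ... | inj₁ p | inj₁ q with bound N 1 (search-slack W₁ _ _ S p q) | bound βαγκ 0 (search₀ W₁ _ _)
      ...   | inj₁ ((_ ∷ []) , _ , F , refl) | _ = ⊥-elim (noHam _ F)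
      ...   | inj₂ _ | inj₁ ((_ ∷ []) , _ , F , refl) = ⊥-elim (noHam _ F)
      ...   | inj₂ h₁ | inj₂ h₂ = contradiction
              (subst (λ k → 5 ≤ k + k + 0) o
                (few-walks N (apart N) far far′ 1 0 0 (≤-trans h₁ (m≤m+n E 0))
                  (≤-trans (m≤m+n _ 0) (≤-trans h₂ (m≤m+n E 0)))))
              λ { (s≤s (s≤s (s≤s (s≤s ())))) }
        where
        E = edgeTotal (⟨ W₁ ⟩ ∷ ⟨ W₂ ⟩ ∷ [])
        far′ : e β x y ≡ 0
        far′ with zero⊎pos (e β x y)
        ... | inj₁ eq = eq
        ... | inj₂ p  = ⊥-elim (noHam _ (merge βαγκ p))

    exact₂ : ∀ {s x y t α β γ κ} {W₁ : Walk s x} {W₂ : Walk y t} → NearPath W₁ W₂ α β γ κ →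
             (S : Split W₂) → e α x (Split.a S) + e β y (Split.b S) ≡ 1
    exact₂ {y = y} {β = β} N S = trans (+-comm _ (e β y (Split.b S))) (exact (swap N) (flipSplit S))

    far-start : ∀ {s x y t α β γ κ} {W₁ : Walk s x} {W₂ : Walk y t} → NearPath W₁ W₂ α β γ κ → e β y s ≡ 0
    far-start {y = y} {β = β} N = trans (e-sym β y _) (far (flip (βαγκ N)))

    far-end : ∀ {s x y t α β γ κ} {W₁ : Walk s x} {W₂ : Walk y t} → NearPath W₁ W₂ α β γ κ → e β y x ≡ 0
    far-end {y = y} {β = β} N = trans (e-sym β y _) (far (βαγκ N))

    same-colour₁ : ∀ {s x y t α β γ κ} {W₁ : Walk s x} {W₂ : Walk y t} → NearPath W₁ W₂ α β γ κ →
                   ∀ {w} → w ∈ W₁ → e β y w ≡ e γ y w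
    same-colour₁ {W₁ = W₁} N m with at-start W₁ m
    ... | inj₁ refl       = trans (far-start N) (≡sym (far-start (αγβκ N)))
    ... | inj₂ (S , refl) = complement (exact N S) (exact (αγβκ N) S)

    same-colour₂ : ∀ {s x y t α β γ κ} {W₁ : Walk s x} {W₂ : Walk y t} → NearPath W₁ W₂ α β γ κ →
                   ∀ {w} → w ∈ W₂ → e β y w ≡ e γ y w
    same-colour₂ {β = β} {γ} {W₂ = W₂} N m with at-start W₂ m
    ... | inj₁ refl       = trans (e-irrefl β _) (≡sym (e-irrefl γ _))
    ... | inj₂ (S , refl) = complement (exact₂ N S) (exact₂ (αγβκ N) S)

    same-colour : ∀ {s x y t α β γ κ} {W₁ : Walk s x} {W₂ : Walk y t} → NearPath W₁ W₂ α β γ κ →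
                  ∀ {w} → Inner O w → e β y w ≡ e γ y w
    same-colour N i = [ same-colour₁ N , same-colour₂ N ]′ (inner-∈ N i)

    -- The neighbourhood of `x` determines that of either end of `W₂`, since `W₂` may be reversed.
    same-end₁ : ∀ {s x y t α β γ κ} {W₁ : Walk s x} {W₂ : Walk y t} → NearPath W₁ W₂ α β γ κ →
                ∀ {w} → w ∈ W₁ → e β y w ≡ e β t w
    same-end₁ {W₁ = W₁} N m with at-start W₁ m
    ... | inj₁ refl       = trans (far-start N) (≡sym (far-start (flip₂ N)))
    ... | inj₂ (S , refl) = complement (exact N S) (exact (flip₂ N) S)

    -- The separated case: y has no neighbour on W₁ and x none on W₂.

    module Separated where

      Q₁ : ∀ {s x y t} → Walk s x → Walk y t → Fin n → Set
      Q₁ {y = y} W₁ _ β = Σv W₁ (e β y) ≡ 0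

      recolour : ∀ {s x y t α β γ κ} {W₁ : Walk s x} {W₂ : Walk y t} → NearPath W₁ W₂ α β γ κ →
                 Q₁ W₁ W₂ β → Q₁ W₁ W₂ γ
      recolour {W₁ = W₁} N q = trans (≡sym (Σv-cong W₁ λ w p → same-colour₁ N (mem p))) q

      reverse : ∀ {s x y t α β γ κ} {W₁ : Walk s x} {W₂ : Walk y t} → NearPath W₁ W₂ α β γ κ →
                Q₁ W₁ W₂ β → Q₁ W₁ (rev W₂) β
      reverse {W₁ = W₁} N q = trans (≡sym (Σv-cong W₁ λ w p → same-end₁ N (mem p))) q

      -- Since `y` sees nothing on `W₁`, `exact` makes `x` see the tail of every edge. Rotating over
      -- the edge coloured `c` releases `c`, and then `recolour` applies.
      used-colour : ∀ {s x y t α β γ κ c} {W₁ : Walk s x} {W₂ : Walk y t} → NearPath W₁ W₂ α β γ κ →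
                    Q₁ W₁ W₂ β → 0 < Σc W₁ (δ c) → Q₁ W₁ W₂ c
      used-colour {y = y} {β = β} {W₁ = W₁} N q p with colour-split W₁ p
      ... | S , refl with W₁′ , N′ , veq ← rotate N S (one-left (exact N S) (zero-b (e β y) q S))
        = trans (≡sym (veq _)) (recolour (γβακ N′) (trans (veq _) q))

      other-vertex : ∀ {s x y t α β γ κ w} {W₁ : Walk s x} {W₂ : Walk y t} → NearPath W₁ W₂ α β γ κ →
                     Q₁ W₁ W₂ β → Σv W₂ (e α x) ≡ 0 → w ∈ W₂ →
                     (Σv W₁ (e β w) ≡ 0) × (∀ {c} → 0 < Σc W₁ (δ c) → Σv W₁ (e c w) ≡ 0)
      other-vertex {x = x} {α = α} {W₁ = W₁} {W₂} N q₁ q₂ m with at-start W₂ m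
      ... | inj₁ refl = q₁ , used-colour N q₁
      ... | inj₂ (S , refl)
            with W₂′ , N′ , _ ← rotate (pullᵂ 1st (γβακ N)) S
                   (one-left (exact (pullᵂ 1st (flip (pullᶜ 2nd N))) S) (zero-b (e α x) q₂ S))
        = let N″ = pullᵂ 1st N′ in reverse N″ q₁ , used-colour (flip₂ N″) (reverse N″ q₁)

      separate-used : ∀ {s x y t α β γ κ c z w} {W₁ : Walk s x} {W₂ : Walk y t} → NearPath W₁ W₂ α β γ κ →
                      Q₁ W₁ W₂ β → Σv W₂ (e α x) ≡ 0 → 0 < Σc W₁ (δ c) → z ∈ W₁ → w ∈ W₂ → e c w z ≡ 0
      separate-used {W₁ = W₁} N q₁ q₂ p mz mw =
        zero-∈ W₁ _ (proj₂ (other-vertex N q₁ q₂ mw) p) mz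

      separate : ∀ {s x y t α β γ κ} {W₁ : Walk s x} {W₂ : Walk y t} → NearPath W₁ W₂ α β γ κ →
                 Q₁ W₁ W₂ β → Σv W₂ (e α x) ≡ 0 → ∀ c {z w} → z ∈ W₁ → w ∈ W₂ → e c w z ≡ 0
      separate {α = α} {β} {γ} {κ} {W₁ = W₁} {W₂} N q₁ q₂ c {z} {w} mz mw
        with pos-+ (Σc W₁ (δ c) + (Σc W₂ (δ c) + 0)) (subst (0 <_) (≡sym (trans (col N (δ c)) (sum-δ c))) z<s)
      ... | inj₁ p with pos-+ (Σc W₁ (δ c)) p
      ...   | inj₁ p₁ = separate-used N q₁ q₂ p₁ mz mw
      ...   | inj₂ p₂ = trans (e-sym c w z)
                (separate-used {W₁ = rev W₂} {rev W₁} (swap N) q₂ q₁ (subst (0 <_) (+-identityʳ _) p₂)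
                  (mem (occurs mw)) (mem (occurs mz)))
      separate {α = α} {β} {γ} {κ} {W₁ = W₁} {W₂} N q₁ q₂ c {z} {w} mz mw | inj₂ p with pick-pos (δ c) _ p
      ... | _ , _ , pk , d with refl ← δ-pos {w = c} d = spare pk
        where
        by-second : ∀ {α β γ κ} → NearPath W₁ W₂ α β γ κ → Q₁ W₁ W₂ β → Σv W₂ (e α _) ≡ 0 → e β w z ≡ 0
        by-second N q₁ q₂ = zero-∈ W₁ _ (proj₁ (other-vertex N q₁ q₂ mw)) mz
        spare : ∀ {R} → Pick (α ∷ β ∷ γ ∷ κ ∷ []) c R → e c w z ≡ 0
        spare here = by-second (βαγκ N) (recolour (γβακ N) q₁) (recolour (γβακ (swap N)) q₂)
        spare 1st  = by-second N q₁ q₂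
        spare 2nd  = by-second (αγβκ N) (recolour N q₁) q₂
        spare 3rd  = by-second (αγβκ (αβκγ N)) (recolour (αβκγ N) q₁) q₂

    -- The alternating case: y has a neighbour on W₁.

    module Alternating where

      -- The edges xa and sb close W₁ up to a cycle, which is then opened next to a neighbour of y.
      cycle : ∀ {s x y t α β γ κ} {W₁ : Walk s x} {W₂ : Walk y t} → NearPath W₁ W₂ α β γ κ → (S : Split W₁) →
              0 < e α x (Split.a S) → 0 < e γ s (Split.b S) → 0 < Σv (Split.A S) (e β y) → ⊥
      cycle {s} {y = y} {β = β} N S p q r with locateˡ (Split.A S) (e β y) r
      ... | inj₁ r₀ = contradiction (subst (0 <_) (far-start N) r₀) λ ()
      ... | inj₂ (S′ , r′) = noHam _
            (merge (pullᶜ 2nd (merge (pullᶜ 2nd (merge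
              (pullᶜ 4th (pullᵂ 2nd (pullᵂ 2nd (flip (pullᵂ 1st (flip (cut (cut N S) S′))))))) q)) p)) (e-flip r′))

      module _ {s x y t α β γ κ} {W₁ : Walk s x} {W₂ : Walk y t} (N : NearPath W₁ W₂ α β γ κ)
               (touch : 0 < Σv W₁ (e β y)) where

        -- If `y` sees neither a nor b, then `x` sees a and `s` sees b, and `W₁` closes up to a
        -- cycle. If `y` sees both, then `x` misses a, hence `t` sees b, and `W₂` can be inserted
        -- between a and b.
        alternate₁ : (S : Split W₁) → e β y (Split.a S) + e β y (Split.b S) ≡ 1
        alternate₁ S with zero⊎pos (e β y (Split.a S)) | zero⊎pos (e β y (Split.b S))
        ... | inj₁ p | inj₂ q rewrite p = pos⇒1 q
        ... | inj₂ p | inj₁ q rewrite q | pos⇒1 p = refl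
        ... | inj₁ p | inj₁ q = ⊥-elim
              ([ cycle N S xa sb , cycle (flip (γβακ N)) (flipSplit S) sb xa ]′
                (pos-+ (Σv (Split.A S) (e β y)) (subst (0 <_) (Split.veq S (e β y)) touch)))
          where
          xa = one-left (exact N S) q
          sb = one-left (exact (flip (γβακ N)) (flipSplit S)) p
        ... | inj₂ p | inj₂ q = ⊥-elim (noHam _
                (merge (pullᶜ 2nd (merge (pullᶜ 2nd (pullᵂ 1st (pullᵂ 2nd (cut N S)))) (e-flip p))) tb))
          where
          xa≡0 : e α x (Split.a S) ≡ 0
          xa≡0 = +-cancelʳ-≡ 1 _ 0 (subst (λ k → e α x (Split.a S) + k ≡ 1) (pos⇒1 q) (exact N S))
          tb : 0 < e γ t (Split.b S)
          tb = one-left (trans (+-comm _ (e α x (Split.a S))) (exact (flip₂ (αγβκ N)) S)) xa≡0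

      module _ {s x y t α β γ κ} {W₁ : Walk s x} {W₂ : Walk y t} (N : NearPath W₁ W₂ α β γ κ)
               (touch : 0 < Σv W₁ (e β y)) where

        -- Regroup into s … w y … t and w′ … x, where w is a neighbour of y on W₁.
        alternate₂ : (S : Split W₂) → e γ x (Split.a S) + e γ x (Split.b S) ≡ 1
        alternate₂ S with locateʳ W₁ (e β y) touch
        ... | inj₁ r = contradiction (subst (0 <_) (far-end N) r) λ ()
        ... | inj₂ (S′ , r) = alternate₁ N′ xw (inʳ (Split.A S′) β (e-edge (e-flip r)) S)
          where
          yw′≡0 : e β y (Split.b S′) ≡ 0
          yw′≡0 = +-cancelˡ-≡ 1 _ 0 (subst (λ k → k + e β y (Split.b S′) ≡ 1) (pos⇒1 r) (alternate₁ N touch S′))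
          N′ : NearPath (join (Split.A S′) β (e-edge (e-flip r)) W₂) (rev (Split.B S′)) (Split.c S′) γ α κ
          N′ = pullᶜ 1st (pullᶜ 2nd (merge (pullᶜ 2nd (pullᵂ 1st (pullᵂ 2nd (pullᵂ 1st (flip (pullᵂ 1st (cut N S′)))))))
                                           (e-flip r)))
          xw : 0 < Σv (join (Split.A S′) β (e-edge (e-flip r)) W₂) (e γ x)
          xw = pos-+ˡ _ (≤-trans (one-left (exact (γβακ N) S′) yw′≡0) (Σv-end (Split.A S′) (e γ x)))

        -- On an edge of `W₁` both values at one endpoint are complementary to that of `y` at the
        -- other; on an edge of `W₂`, to that of `x` at the other.
        opposite : ∀ {w} → Inner O w → e γ x w ≡ e β y w
        opposite {w} i with inner-∈ N i
        ... | inj₁ m with at-end W₁ m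
        ...   | inj₁ refl = trans (e-irrefl γ x) (≡sym (far-end N))
        ...   | inj₂ (S , refl) = +-cancelʳ-≡ (e β y (Split.b S)) _ _ (trans (exact (γβακ N) S) (≡sym (alternate₁ N touch S)))
        opposite {w} i | inj₂ m with at-start W₂ m
        ...   | inj₁ refl = trans (far (γβακ N)) (≡sym (e-irrefl β y))
        ...   | inj₂ (S , refl) = complement (alternate₂ S) (exact₂ (γβακ N) S)

      same-end : ∀ {s x y t α β γ κ} {W₁ : Walk s x} {W₂ : Walk y t} (N : NearPath W₁ W₂ α β γ κ) →
                 0 < Σv W₁ (e β y) → ∀ {w} → Inner O w → e β t w ≡ e β y w
      same-end {W₁ = W₁} N touch i = trans (≡sym (opposite (flip₂ N) touch′ i)) (opposite N touch i)
        where touch′ = subst (0 <_) (Σv-cong W₁ λ w p → same-end₁ N (mem p)) touch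

      record Alternation {s x y t} (J : Fin n → ℕ) (W₁ : Walk s x) (W₂ : Walk y t) (α β γ κ : Fin n) : Set where
        constructor alternation
        field
          near : NearPath W₁ W₂ α β γ κ
          some : 0 < Σv W₁ J
          nbhd : ∀ {w} → Inner O w → e β y w ≡ J w
      open Alternation

      module _ {J : Fin n → ℕ} where

        touch : ∀ {s x y t α β γ κ} {W₁ : Walk s x} {W₂ : Walk y t} →
                Alternation J W₁ W₂ α β γ κ → 0 < Σv W₁ (e β y)
        touch {W₁ = W₁} T =
          subst (0 <_) (≡sym (Σv-cong W₁ λ w p → nbhd T (∈-inner₁ (near T) (mem p)))) (some T)

        module _ {s x y t α β γ κ} {W₁ : Walk s x} {W₂ : Walk y t} (T : Alternation J W₁ W₂ α β γ κ) where

          private N = near T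

          a-inner₁ : (S : Split W₁) → Inner O (Split.a S)
          a-inner₁ S = ∈-inner₁ N (a-∈ S)

          b-inner₁ : (S : Split W₁) → Inner O (Split.b S)
          b-inner₁ S = ∈-inner₁ N (b-∈ S)

          a-inner₂ : (S : Split W₂) → Inner O (Split.a S)
          a-inner₂ S = ∈-inner₂ N (a-∈ S)

          b-inner₂ : (S : Split W₂) → Inner O (Split.b S)
          b-inner₂ S = ∈-inner₂ N (b-∈ S)

          J-edge₁ : (S : Split W₁) → J (Split.a S) + J (Split.b S) ≡ 1
          J-edge₁ S = trans (≡sym (cong₂ _+_ (nbhd T (a-inner₁ S)) (nbhd T (b-inner₁ S)))) (alternate₁ N (touch T) S)

          nbhd-γx : ∀ {w} → Inner O w → e γ x w ≡ J w
          nbhd-γx i = trans (opposite N (touch T) i) (nbhd T i)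

          J-edge₂ : (S : Split W₂) → J (Split.a S) + J (Split.b S) ≡ 1
          J-edge₂ S = trans (≡sym (cong₂ _+_ (nbhd-γx (a-inner₂ S)) (nbhd-γx (b-inner₂ S)))) (alternate₂ N (touch T) S)

          A-flip₁ : Alternation J (rev W₁) W₂ α β γ κ
          A-flip₁ = alternation (flip N) (some T) (nbhd T)

          A-flip₂ : Alternation J W₁ (rev W₂) α β γ κ
          A-flip₂ = alternation (flip₂ N) (some T) (λ i → trans (same-end N (touch T) i) (nbhd T i))

          A-αγβκ : Alternation J W₁ W₂ α γ β κ
          A-αγβκ = alternation (αγβκ N) (some T) (λ i → trans (≡sym (same-colour N i)) (nbhd T i))

          A-γβακ : Alternation J W₁ W₂ γ β α κ
          A-γβακ = alternation (γβακ N) (some T) (nbhd T)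

          A-αβκγ : Alternation J W₁ W₂ α β κ γ
          A-αβκγ = alternation (αβκγ N) (some T) (nbhd T)

        nbhd-αx : ∀ {s x y t α β γ κ} {W₁ : Walk s x} {W₂ : Walk y t} → Alternation J W₁ W₂ α β γ κ →
                  ∀ {w} → Inner O w → e α x w ≡ J w
        nbhd-αx T = nbhd-γx (A-γβακ T)

        nbhd-αy : ∀ {s x y t α β γ κ} {W₁ : Walk s x} {W₂ : Walk y t} → Alternation J W₁ W₂ α β γ κ →
                  ∀ {w} → Inner O w → e α y w ≡ J w
        nbhd-αy T = nbhd (A-αγβκ (A-γβακ T))

        rotate₁ : ∀ {s x y t α β γ κ} {W₁ : Walk s x} {W₂ : Walk y t} → Alternation J W₁ W₂ α β γ κ →
                  (S : Split W₁) → 0 < J (Split.a S) →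
                  Σ (Walk s (Split.b S)) λ W₁′ → Alternation J W₁′ W₂ (Split.c S) β γ κ
        rotate₁ T S p with W₁′ , N′ , veq ← rotate (near T) S (subst (0 <_) (≡sym (nbhd-αx T (a-inner₁ T S))) p)
          = W₁′ , alternation N′ (subst (0 <_) (≡sym (veq J)) (some T)) (nbhd T)

        rotate₂ : ∀ {s x y t α β γ κ} {W₁ : Walk s x} {W₂ : Walk y t} → Alternation J W₁ W₂ α β γ κ →
                  (S : Split W₂) → 0 < J (Split.a S) →
                  Σ (Walk y (Split.b S)) λ W₂′ → Alternation J W₁ W₂′ (Split.c S) β γ κ
        rotate₂ T S p with W₂′ , N′ , _ ← rotate (pullᵂ 1st (near T)) S
                             (subst (0 <_) (≡sym (nbhd-αy (A-flip₂ T) (a-inner₂ T S))) p)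
          = W₂′ , alternation (pullᵂ 1st N′) (some T) (nbhd T)

        data Freed (c : Fin n) : Set where
          freed : ∀ {s x y t β γ κ} {W₁ : Walk s x} {W₂ : Walk y t} → Alternation J W₁ W₂ c β γ κ → Freed c

        one-pos : ∀ {p q} → p + q ≡ 1 → 0 < p ⊎ 0 < q
        one-pos {p} eq = pos-+ p (subst (0 <_) (≡sym eq) z<s)

        -- Exactly one endpoint of an edge lies in `J`, and both ends of its walk see all of `J`.
        -- One of these ends can therefore rotate over the edge and release its colour.
        free : ∀ {s x y t α β γ κ} {W₁ : Walk s x} {W₂ : Walk y t} → Alternation J W₁ W₂ α β γ κ → ∀ c → Freed c
        free {α = α} {β} {γ} {κ} {W₁} {W₂} T c
          with pos-+ (Σc W₁ (δ c) + (Σc W₂ (δ c) + 0)) (subst (0 <_) (≡sym (trans (col (near T) (δ c)) (sum-δ c))) z<s)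
        ... | inj₂ p with pick-pos (δ c) _ p
        ...   | _ , _ , pk , d with refl ← δ-pos {w = c} d = spare pk
          where
          spare : ∀ {R} → Pick (α ∷ β ∷ γ ∷ κ ∷ []) c R → Freed c
          spare here = freed T
          spare 1st  = freed (A-γβακ (A-αγβκ T))
          spare 2nd  = freed (A-γβακ T)
          spare 3rd  = freed (A-γβακ (A-αβκγ T))
        free {W₁ = W₁} {W₂} T c | inj₁ p with pos-+ (Σc W₁ (δ c)) p
        ... | inj₁ p₁ with S , refl ← colour-split W₁ p₁ with one-pos (J-edge₁ T S)
        ...   | inj₁ q = freed (proj₂ (rotate₁ T S q))
        ...   | inj₂ q = freed (proj₂ (rotate₁ (A-flip₁ T) (flipSplit S) q))
        free {W₁ = W₁} {W₂} T c | inj₁ p | inj₂ p₂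
          with S , refl ← colour-split W₂ (subst (0 <_) (+-identityʳ _) p₂) with one-pos (J-edge₂ T S)
        ...   | inj₁ q = freed (proj₂ (rotate₂ T S q))
        ...   | inj₂ q = freed (proj₂ (rotate₂ (A-flip₂ T) (flipSplit S) q))

        common-nbhd′ : ∀ {s x y t c β γ κ} {W₁ : Walk s x} {W₂ : Walk y t} → Alternation J W₁ W₂ c β γ κ →
                       ∀ {z w} → Inner O z → J z ≡ 0 → Inner O w → e c z w ≡ J w
        common-nbhd′ {W₁ = W₁} {W₂} T i Jz j with inner-∈ (near T) i
        ... | inj₁ m with at-start W₁ m
        ...   | inj₁ refl = nbhd-αx (A-flip₁ T) j
        ...   | inj₂ (S , refl) = nbhd-γx (proj₂ (rotate₁ (A-γβακ T) S (one-left (J-edge₁ T S) Jz))) j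
        common-nbhd′ {W₁ = W₁} {W₂} T i Jz j | inj₂ m with at-start W₂ m
        ...   | inj₁ refl = nbhd-αy T j
        ...   | inj₂ (S , refl) =
                nbhd (A-αγβκ (A-flip₂ (proj₂ (rotate₂ (A-γβακ T) S (one-left (J-edge₂ T S) Jz))))) j

        common-nbhd : ∀ {s x y t α β γ κ} {W₁ : Walk s x} {W₂ : Walk y t} → Alternation J W₁ W₂ α β γ κ →
                      ∀ c {z w} → Inner O z → J z ≡ 0 → Inner O w → e c z w ≡ J w
        common-nbhd T c with freed T′ ← free T c = common-nbhd′ T′

-- Separated walks give (B2)

module Extremal {n : ℕ} (G : Collection n n) (σ : ∀ i → σ₂≥ (G i) n) {u v : Fin n}
                (noHam : ∀ {y z Q} (W : Walks.Walk G y z) →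
                         ¬ Forests.Forest G (u ∷ v ∷ []) ((_ , _ , W) ∷ []) Q) where

  open Core G σ
  open Near {u ∷ v ∷ []} refl noHam

  private
    O : List (Fin n)
    O = u ∷ v ∷ []

  inner-≢ : ∀ {w} → w ≢ u → w ≢ v → Inner O w
  inner-≢ w≢u w≢v = inner (cong₂ (λ a b → a + (b + 0)) (δ-≢ w≢u) (δ-≢ w≢v))

  ≢u : ∀ {w} → Inner O w → w ≢ u
  ≢u i refl with () ← trans (cong (_+ (δ u v + 0)) (≡sym (δ-refl u))) (Inner.absent i)

  ≢v : ∀ {w} → Inner O w → w ≢ v
  ≢v i refl = contradiction
    (trans (cong (λ z → z + 0) (≡sym (δ-refl v))) (m+n≡0⇒n≡0 (δ v u) (Inner.absent i))) λ ()

  module Cliques {s x y t α β γ κ} {W₁ : Walk s x} {W₂ : Walk y t} (N : NearPath W₁ W₂ α β γ κ)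
                 (separated : ∀ c {z w} → z ∈ W₁ → w ∈ W₂ → e c w z ≡ 0) where

    disjoint : ∀ {w} → w ∈ W₁ → w ∈ W₂ → ⊥
    disjoint {w} m₁ m₂ = <-irrefl refl (begin-strict
      1                                               <⟨ ≤-refl ⟩
      1 + 1                                           ≤⟨ +-mono-≤ (_∈_.occurs m₁) (_∈_.occurs m₂) ⟩
      Σv W₁ (δ w) + Σv W₂ (δ w)                       ≤⟨ +-monoʳ-≤ (Σv W₁ (δ w)) (m≤m+n _ 0) ⟩
      Σv W₁ (δ w) + (Σv W₂ (δ w) + 0)                 ≤⟨ m≤m+n _ (total (δ w) O) ⟩
      Σv W₁ (δ w) + (Σv W₂ (δ w) + 0) + total (δ w) O ≡⟨ cov N (δ w) ⟩
      sum (δ w)                                       ≡⟨ sum-δ w ⟩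
      1                                               ∎)
      where open ≤-Reasoning

    δ-≢₁₂ : ∀ {z w} → z ∈ W₁ → w ∈ W₂ → δ z w ≡ 0
    δ-≢₁₂ {z} {w} m₁ m₂ = δ-≢ {w = z} {w} λ { refl → disjoint m₁ m₂ }

    δ-≢₂₁ : ∀ {z w} → z ∈ W₂ → w ∈ W₁ → δ z w ≡ 0
    δ-≢₂₁ {z} {w} m₁ m₂ = δ-≢ {w = z} {w} λ { refl → disjoint m₂ m₁ }

    separated′ : ∀ c {z w} → z ∈ W₁ → w ∈ W₂ → e c z w ≡ 0
    separated′ c m₁ m₂ = trans (e-sym c _ _) (separated c m₁ m₂)

    e+δ≤1 : ∀ c z w → e c z w + δ z w ≤ 1
    e+δ≤1 c z w with z ≟ w
    ... | yes refl rewrite irrefl (G c) z = ≤-refl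
    ... | no _ = ≤-trans (≤-reflexive (+-identityʳ _)) (e≤1 c z w)

    module _ (c : Fin n) {z w} (z∈ : z ∈ W₁) (w∈ : w ∈ W₂) where

      -- The `δ` terms of `lhs` stand in for the missing loops at `z` and `w`, so an inner vertex
      -- counts at most once; those of `rhs` allow `u` and `v` to count twice. The totals are the
      -- degree sum plus 2 and n + 2.
      lhs rhs : Fin n → ℕ
      lhs q = (e c z q + e c w q) + (δ z q + δ w q)
      rhs q = 1 + (δ u q + δ v q)

      private
        regroup : ∀ a b c d → (a + b) + (c + d) ≡ (a + c) + (b + d)
        regroup = solve-∀
        at-inner : ∀ q → q ∈ W₁ ⊎ q ∈ W₂ → lhs q ≤ 1
        at-inner q (inj₁ m) = begin
          lhs q                                     ≡⟨ regroup (e c z q) (e c w q) (δ z q) (δ w q) ⟩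
          (e c z q + δ z q) + (e c w q + δ w q)     ≡⟨ cong ((e c z q + δ z q) +_)
                                                        (cong₂ _+_ (separated c m w∈) (δ-≢₂₁ w∈ m)) ⟩
          (e c z q + δ z q) + 0                     ≡⟨ +-identityʳ _ ⟩
          e c z q + δ z q                           ≤⟨ e+δ≤1 c z q ⟩
          1                                         ∎
          where open ≤-Reasoning
        at-inner q (inj₂ m) = begin
          lhs q                                     ≡⟨ regroup (e c z q) (e c w q) (δ z q) (δ w q) ⟩
          (e c z q + δ z q) + (e c w q + δ w q)     ≡⟨ cong (_+ (e c w q + δ w q))
                                                        (cong₂ _+_ (separated′ c z∈ m) (δ-≢₁₂ z∈ m)) ⟩
          e c w q + δ w q                           ≤⟨ e+δ≤1 c w q ⟩
          1                                         ∎
          where open ≤-Reasoning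

      outer-sum : ∀ q → q ≡ u ⊎ q ≡ v → δ z q + δ w q ≡ 0
      outer-sum q (inj₁ refl) = cong₂ _+_ (δ-≢ (≢u (∈-inner₁ N z∈))) (δ-≢ (≢u (∈-inner₂ N w∈)))
      outer-sum q (inj₂ refl) = cong₂ _+_ (δ-≢ (≢v (∈-inner₁ N z∈))) (δ-≢ (≢v (∈-inner₂ N w∈)))

      pointwise : ∀ q → lhs q ≤ rhs q
      pointwise q with q ≟ u | q ≟ v
      ... | yes refl | _ = begin
        lhs q                     ≡⟨ cong ((e c z q + e c w q) +_) (outer-sum q (inj₁ refl)) ⟩
        (e c z q + e c w q) + 0   ≡⟨ +-identityʳ _ ⟩
        e c z q + e c w q         ≤⟨ +-mono-≤ (e≤1 c z q) (e≤1 c w q) ⟩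
        1 + 1                     ≡⟨ cong (1 +_) (δ-refl q) ⟨
        1 + δ q q                 ≤⟨ +-monoʳ-≤ 1 (m≤m+n _ _) ⟩
        rhs q                     ∎
        where open ≤-Reasoning
      ... | no _ | yes refl = begin
        lhs q                     ≡⟨ cong ((e c z q + e c w q) +_) (outer-sum q (inj₂ refl)) ⟩
        (e c z q + e c w q) + 0   ≡⟨ +-identityʳ _ ⟩
        e c z q + e c w q         ≤⟨ +-mono-≤ (e≤1 c z q) (e≤1 c w q) ⟩
        1 + 1                     ≡⟨ cong (1 +_) (δ-refl q) ⟨
        1 + δ q q                 ≤⟨ +-monoʳ-≤ 1 (m≤n+m _ (δ u q)) ⟩
        rhs q                     ∎
        where open ≤-Reasoning
      ... | no q≢u | no q≢v = ≤-trans (at-inner q (inner-∈ N (inner-≢ q≢u q≢v))) (s≤s z≤n)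

      -- The degree sum of z and w is at most n, so it is attained vertex by vertex.
      tight : ∀ q → lhs q ≡ rhs q
      tight = sum-squeeze pointwise (begin
        sum rhs                                       ≡⟨ ∑-distrib-+ (λ _ → 1) (λ q → δ u q + δ v q) ⟩
        sum {n} (λ _ → 1) + sum (λ q → δ u q + δ v q) ≡⟨ cong₂ _+_ (sum-one n) (two-δ u v) ⟩
        n + 2                                         ≤⟨ +-monoˡ-≤ 2 (σ c z w (λ { refl → disjoint z∈ w∈ })
                                                                        (e≡0 (separated′ c z∈ w∈))) ⟩
        (deg (G c) z + deg (G c) w) + 2               ≡⟨ cong₂ _+_ (cong₂ _+_ (deg≡sum c z) (deg≡sum c w)) (≡sym (two-δ z w)) ⟩
        (sum (e c z) + sum (e c w)) + sum (λ q → δ z q + δ w q)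
          ≡⟨ cong (_+ sum (λ q → δ z q + δ w q)) (∑-distrib-+ (e c z) (e c w)) ⟨
        sum (λ q → e c z q + e c w q) + sum (λ q → δ z q + δ w q)
          ≡⟨ ∑-distrib-+ (λ q → e c z q + e c w q) (λ q → δ z q + δ w q) ⟨
        sum lhs                                       ∎)
        where
        open ≤-Reasoning
        two-δ : ∀ a b → sum (λ q → δ a q + δ b q) ≡ 2
        two-δ a b = trans (∑-distrib-+ (δ a) (δ b)) (cong₂ _+_ (sum-δ a) (sum-δ b))

      near₁ : ∀ {q} → q ∈ W₁ → z ≢ q → z ~[ G c ] q
      near₁ {q} m z≢q = e-edge (subst (0 <_) (begin
        rhs q                       ≡⟨ tight q ⟨
        lhs q                       ≡⟨ cong₂ _+_ (cong (e c z q +_) (separated c m w∈))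
                                                 (cong₂ _+_ (δ-≢ z≢q) (δ-≢₂₁ w∈ m)) ⟩
        e c z q + 0 + (0 + 0)       ≡⟨ trans (+-identityʳ _) (+-identityʳ _) ⟩
        e c z q                     ∎) z<s)
        where open ≡-Reasoning

      near₂ : ∀ {q} → q ∈ W₂ → w ≢ q → w ~[ G c ] q
      near₂ {q} m w≢q = e-edge (subst (0 <_) (begin
        rhs q                       ≡⟨ tight q ⟨
        lhs q                       ≡⟨ cong₂ _+_ (cong (_+ e c w q) (separated′ c z∈ m))
                                                 (cong₂ _+_ (δ-≢₁₂ z∈ m) (δ-≢ w≢q)) ⟩
        e c w q + (0 + 0)           ≡⟨ +-identityʳ _ ⟩
        e c w q                     ∎) z<s)
        where open ≡-Reasoning

      both : ∀ q → q ≡ u ⊎ q ≡ v → (q ~[ G c ] z) × (q ~[ G c ] w)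
      both q h =
        let p , r = ≤-both-1 (e≤1 c z q) (e≤1 c w q) (begin
                2                         ≤⟨ s≤s (one h) ⟩
                rhs q                     ≡⟨ tight q ⟨
                lhs q                     ≡⟨ cong ((e c z q + e c w q) +_) (outer-sum q h) ⟩
                (e c z q + e c w q) + 0   ≡⟨ +-identityʳ _ ⟩
                e c z q + e c w q         ∎)
        in ~sym (e-edge p) , ~sym (e-edge r)
        where
        open ≤-Reasoning
        one : q ≡ u ⊎ q ≡ v → 1 ≤ δ u q + δ v q
        one (inj₁ refl) = ≤-trans (≤-reflexive (≡sym (δ-refl q))) (m≤m+n _ _)
        one (inj₂ refl) = ≤-trans (≤-reflexive (≡sym (δ-refl q))) (m≤n+m _ (δ u q))

    outcomeB2 : OutcomeB2 G u v
    outcomeB2 = inX , (s , X-intro (start-∈ W₁)) , (t , Y-intro (end-∈ W₂)) , λ c →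
        (λ z z′ Z Z′ z≢z′ → near₁ c (X-elim Z) (start-∈ W₂) (X-elim Z′) z≢z′)
      , (λ w w′ P P′ w≢w′ → near₂ c (start-∈ W₁) (Y-elim P) (Y-elim P′) w≢w′)
      , (λ z w Z P → e≡0 (separated′ c (X-elim Z) (Y-elim P)))
      , λ q q≢u q≢v → case inner-∈ N (inner-≢ q≢u q≢v) of λ
          { (inj₁ m) → proj₁ (both c m (start-∈ W₂) u (inj₁ refl)) , proj₁ (both c m (start-∈ W₂) v (inj₂ refl))
          ; (inj₂ m) → proj₂ (both c (start-∈ W₁) m u (inj₁ refl)) , proj₂ (both c (start-∈ W₁) m v (inj₂ refl)) }
      where
      inX : Fin n → Bool
      inX q = does (0 <? Σv W₁ (δ q))
      X-intro : ∀ {q} → q ∈ W₁ → q ≢ u × q ≢ v × inX q ≡ true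
      X-intro {q} m = ≢u (∈-inner₁ N m) , ≢v (∈-inner₁ N m) , dec-true (0 <? Σv W₁ (δ q)) (_∈_.occurs m)
      Y-intro : ∀ {q} → q ∈ W₂ → q ≢ u × q ≢ v × inX q ≡ false
      Y-intro {q} m = ≢u (∈-inner₂ N m) , ≢v (∈-inner₂ N m) ,
                      dec-false (0 <? Σv W₁ (δ q)) (λ p → disjoint (mem p) m)
      X-elim : ∀ {q} → q ≢ u × q ≢ v × inX q ≡ true → q ∈ W₁
      X-elim {q} (_ , _ , eq) = mem (true-pos _ eq)
        where
        true-pos : ∀ k → does (0 <? k) ≡ true → 0 < k
        true-pos (suc k) _ = z<s
      Y-elim : ∀ {q} → q ≢ u × q ≢ v × inX q ≡ false → q ∈ W₂
      Y-elim {q} (q≢u , q≢v , eq) with inner-∈ N (inner-≢ q≢u q≢v)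
      ... | inj₂ m = m
      ... | inj₁ m with () ← trans (≡sym eq) (dec-true (0 <? Σv W₁ (δ q)) (_∈_.occurs m))

  -- Alternating walks give (B3)

  -- Each edge contains exactly one unit of `J`. Summing over the edges counts interior vertices
  -- twice and the ends once, whence the correction `J s + J x`.
  alternating-count : ∀ {s x} (W : Walk s x) J → (∀ (S : Split W) → J (Split.a S) + J (Split.b S) ≡ 1) →
                      Σv W J + Σv W J ≡ edges W + (J s + J x)
  alternating-count (pt x) J h = refl
  alternating-count (join {s} {b} {b′} {x} A c p B) J h = begin
    (Σv A J + Σv B J) + (Σv A J + Σv B J)   ≡⟨ gather (Σv A J) (Σv B J) ⟩
    (Σv A J + Σv A J) + (Σv B J + Σv B J)   ≡⟨ cong₂ _+_ (alternating-count A J (h ∘ inˡ c p B))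
                                                         (alternating-count B J (h ∘ inʳ A c p)) ⟩
    (edges A + (J s + J b)) + (edges B + (J b′ + J x))
                                            ≡⟨ ends (edges A) (edges B) (J s) (J b) (J b′) (J x) ⟩
    edges A + (J b + J b′ + edges B) + (J s + J x)
      ≡⟨ cong (λ k → edges A + (k + edges B) + (J s + J x)) (h (joint A c p B)) ⟩
    edges A + (1 + edges B) + (J s + J x)   ∎
    where
    open ≡-Reasoning
    gather : ∀ a b → (a + b) + (a + b) ≡ (a + a) + (b + b)
    gather = solve-∀
    ends : ∀ a b s i j x → (a + (s + i)) + (b + (j + x)) ≡ a + (i + j + b) + (s + x)
    ends = solve-∀
  alternating-count (rev {s} {x} A) J h = trans
    (alternating-count A J λ S → trans (+-comm (J (Split.a S)) _) (h (flipSplit S)))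
    (cong (edges A +_) (+-comm (J s) (J x)))

  module Balanced {s x y t α β γ κ} {W₁ : Walk s x} {W₂ : Walk y t} (N : NearPath W₁ W₂ α β γ κ)
                  (touch : 0 < Σv W₁ (e β y)) where

    open Alternating hiding (touch)

    private
      J : Fin n → ℕ
      J = e β y
      T : Alternation J W₁ W₂ α β γ κ
      T = alternation N touch (λ _ → refl)

      inX : Fin n → Bool
      inX w = does (w ≟ u) ∨ (does (w ≟ v) ∨ adj (G β) y w)

      f : Fin n → ℕ
      f w = ⟦ inX w ⟧

      f-inner : ∀ {w} → Inner O w → f w ≡ J w
      f-inner {w} i with w ≟ u | w ≟ v
      ... | yes refl | _        = contradiction refl (≢u i)
      ... | no _     | yes refl = contradiction refl (≢v i)
      ... | no _     | no _     = refl

      inX-u : inX u ≡ true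
      inX-u = cong (_∨ (does (u ≟ v) ∨ adj (G β) y u)) (dec-true (u ≟ u) refl)

      inX-v : inX v ≡ true
      inX-v = trans (cong (λ b → does (v ≟ u) ∨ (b ∨ adj (G β) y v)) (dec-true (v ≟ v) refl))
                    (∨-zeroʳ (does (v ≟ u)))

      h : ℕ
      h = Σv W₁ J + Σv W₂ J + 2

      sum-f : sum f ≡ h
      sum-f = begin
        sum f                                                     ≡⟨ cov N f ⟨
        Σv W₁ f + (Σv W₂ f + 0) + (f u + (f v + 0))
          ≡⟨ cong₂ (λ a b → a + (b + 0) + (f u + (f v + 0)))
                (Σv-cong W₁ λ w p → f-inner (∈-inner₁ N (mem p)))
                (Σv-cong W₂ λ w p → f-inner (∈-inner₂ N (mem p))) ⟩
        Σv W₁ J + (Σv W₂ J + 0) + (f u + (f v + 0))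
          ≡⟨ cong₂ (λ a b → Σv W₁ J + a + (⟦ b ⟧ + (f v + 0))) (+-identityʳ _) inX-u ⟩
        Σv W₁ J + Σv W₂ J + (1 + (f v + 0))
          ≡⟨ cong (λ b → Σv W₁ J + Σv W₂ J + (1 + (⟦ b ⟧ + 0))) inX-v ⟩
        h ∎
        where open ≡-Reasoning

      x-zero : J x ≡ 0
      x-zero = far-end N

      y-zero : J y ≡ 0
      y-zero = e-irrefl β y

      t-zero : J t ≡ 0
      t-zero = trans (≡sym (same-end N touch (∈-inner₂ N (end-∈ W₂)))) (e-irrefl β t)

      -- The ends of both walks lie outside `J`, so twice the size of `J` is the number of edges,
      -- which is n - 4. The summand 2 in `h` accounts for `u` and `v`.
      n≡h+h : n ≡ h + h
      n≡h+h = begin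
        n
          ≡⟨ order N ⟨
        2 + (edges W₁ + (edges W₂ + 0)) + 2
          ≡⟨ spread (edges W₁) (edges W₂) ⟩
        (edges W₁ + (0 + 0)) + (edges W₂ + (0 + 0)) + 4
          ≡⟨ cong₂ (λ a b → (edges W₁ + a) + (edges W₂ + b) + 4)
               (cong₂ _+_ (far-start N) x-zero) (cong₂ _+_ y-zero t-zero) ⟨
        (edges W₁ + (J s + J x)) + (edges W₂ + (J y + J t)) + 4
          ≡⟨ cong₂ (λ a b → a + b + 4) (alternating-count W₁ J (J-edge₁ T)) (alternating-count W₂ J (J-edge₂ T)) ⟨
        (Σv W₁ J + Σv W₁ J) + (Σv W₂ J + Σv W₂ J) + 4
          ≡⟨ gather (Σv W₁ J) (Σv W₂ J) ⟩
        h + h ∎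
        where
        open ≡-Reasoning
        spread : ∀ a b → 2 + (a + (b + 0)) + 2 ≡ (a + (0 + 0)) + (b + (0 + 0)) + 4
        spread = solve-∀
        gather : ∀ a b → (a + a) + (b + b) + 4 ≡ (a + b + 2) + (a + b + 2)
        gather = solve-∀

      e≤f : ∀ c {z} → Inner O z → J z ≡ 0 → ∀ w → e c z w ≤ f w
      e≤f c {z} i Jz w = by-cases (w ≟ u) (w ≟ v)
        where
        by-cases : Dec (w ≡ u) → Dec (w ≡ v) → e c z w ≤ f w
        by-cases (yes refl) _ = subst (λ b → e c z u ≤ ⟦ b ⟧) (≡sym inX-u) (e≤1 c z u)
        by-cases _ (yes refl) = subst (λ b → e c z v ≤ ⟦ b ⟧) (≡sym inX-v) (e≤1 c z v)
        by-cases (no w≢u) (no w≢v) =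
          let j = inner-≢ w≢u w≢v in ≤-reflexive (trans (common-nbhd T c i Jz j) (≡sym (f-inner j)))

      -- `x` and `y` are distinct and both outside `J`, so one of them differs from `z`.
      partner : ∀ z → ∃[ z′ ] z ≢ z′ × Inner O z′ × J z′ ≡ 0
      partner z with z ≟ x
      ... | no z≢x   = x , z≢x , ∈-inner₁ N (end-∈ W₁) , x-zero
      ... | yes refl = y , apart N , ∈-inner₂ N (start-∈ W₂) , y-zero

      -- z and its partner are non-adjacent with all neighbours in X, so both have degree |X|.
      f-attained : ∀ c {z} → Inner O z → J z ≡ 0 → ∀ w → e c z w ≡ f w
      f-attained c {z} i Jz with partner z
      ... | z′ , z≢z′ , i′ , Jz′ = sum-squeeze (e≤f c i Jz) (begin
        sum f             ≡⟨ sum-f ⟩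
        h                 ≤⟨ +-cancelʳ-≤ h h (sum (e c z)) (begin
            h + h                         ≡⟨ n≡h+h ⟨
            n                             ≤⟨ σ c z z′ z≢z′ (e≡0 (trans (common-nbhd T c i Jz i′) Jz′)) ⟩
            deg (G c) z + deg (G c) z′    ≡⟨ cong₂ _+_ (deg≡sum c z) (deg≡sum c z′) ⟩
            sum (e c z) + sum (e c z′)    ≤⟨ +-monoʳ-≤ (sum (e c z)) (sum-mono (e≤f c i′ Jz′)) ⟩
            sum (e c z) + sum f           ≡⟨ cong (sum (e c z) +_) sum-f ⟩
            sum (e c z) + h               ∎) ⟩
        sum (e c z)       ∎)
        where open ≤-Reasoning

      outside : ∀ {z} → inX z ≡ false → Inner O z × J z ≡ 0
      outside {z} eq = i , trans (≡sym (f-inner i)) (cong ⟦_⟧ eq)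
        where
        i = inner-≢ {z} (λ { refl → contradiction (trans (≡sym eq) inX-u) λ () })
                        (λ { refl → contradiction (trans (≡sym eq) inX-v) λ () })

    outcomeB3 : OutcomeB3 G u v
    outcomeB3 = inX , (h , n≡h+h , trans (count≡sum inX) sum-f , trans (count≡sum (λ w → if inX w then false else true)) sum-complement)
              , inX-u , inX-v , λ c a z a∈ z∉ → let i , Jz = outside z∉ in
                ~sym (e-edge (subst (0 <_) (≡sym (trans (f-attained c i Jz a) (cong ⟦_⟧ a∈))) z<s))
      where
      f+complement : ∀ b → ⟦ b ⟧ + ⟦ (if b then false else true) ⟧ ≡ 1
      f+complement true  = refl
      f+complement false = refl
      sum-complement : sum (λ w → ⟦ (if inX w then false else true) ⟧) ≡ h
      sum-complement = +-cancelˡ-≡ h _ _ (begin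
        h + sum g           ≡⟨ cong (_+ sum g) sum-f ⟨
        sum f + sum g       ≡⟨ ∑-distrib-+ f g ⟨
        sum (λ w → f w + g w) ≡⟨ sum-cong-≗ (λ w → f+complement (inX w)) ⟩
        sum {n} (λ _ → 1)   ≡⟨ sum-one n ⟩
        n                   ≡⟨ n≡h+h ⟩
        h + h               ∎)
        where
        open ≡-Reasoning
        g : Fin n → ℕ
        g w = ⟦ (if inX w then false else true) ⟧

  near-outcome : ∀ {s x y t α β γ κ} {W₁ : Walk s x} {W₂ : Walk y t} → NearPath W₁ W₂ α β γ κ →
                 OutcomeB2 G u v ⊎ OutcomeB3 G u v
  near-outcome {x = x} {y} {α = α} {β} {W₁ = W₁} {W₂} N with zero⊎pos (Σv W₁ (e β y)) | zero⊎pos (Σv W₂ (e α x))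
  ... | inj₂ p | _ = inj₂ (Balanced.outcomeB3 N p)
  ... | inj₁ _ | inj₂ p = inj₂ (Balanced.outcomeB3 (swap N) p)
  ... | inj₁ p | inj₁ q = inj₁ (Cliques.outcomeB2 N (Separated.separate N p q))

-- From walk trees to vertex and colour sequences

module Linearisation {n m : ℕ} (G : Collection m n) where

  open Walks G

  data Path : Fin n → Fin n → ℕ → Set where
    stop : ∀ x → Path x x 0
    step : ∀ {x y z l} c → x ~[ G c ] y → Path y z l → Path x z (suc l)

  vertex : ∀ {x z l} → Path x z l → Fin (suc l) → Fin n
  vertex {x} P            zero    = x
  vertex     (step _ _ P) (suc i) = vertex P i

  colour : ∀ {x z l} → Path x z l → Fin l → Fin m
  colour (step c _ P) zero    = c
  colour (step c _ P) (suc i) = colour P i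

  vertex-last : ∀ {x z l} (P : Path x z l) → vertex P (fromℕ l) ≡ z
  vertex-last (stop x)     = refl
  vertex-last (step _ _ P) = vertex-last P

  colour-edge : ∀ {x z l} (P : Path x z l) i → vertex P (inject₁ i) ~[ G (colour P i) ] vertex P (suc i)
  colour-edge (step c p P) zero    = p
  colour-edge (step c p P) (suc i) = colour-edge P i

  Pv : ∀ {x z l} → Path x z l → (Fin n → ℕ) → ℕ
  Pv P f = sum (f ∘ vertex P)

  Pc : ∀ {x z l} → Path x z l → (Fin m → ℕ) → ℕ
  Pc P f = sum (f ∘ colour P)

  -- The path is tied to its walk only by vertex and colour sums; taken at the indicators `δ`, these
  -- already give injectivity.
  record Line (x z : Fin n) (V : (Fin n → ℕ) → ℕ) (C : (Fin m → ℕ) → ℕ) : Set where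
    constructor line
    field
      {len} : ℕ
      path  : Path x z len
      veq   : ∀ f → Pv path f ≡ V f
      ceq   : ∀ f → Pc path f ≡ C f

  append : ∀ {x b b′ z l l′} (P : Path x b l) c → b ~[ G c ] b′ → (R : Path b′ z l′) →
           Line x z (λ f → Pv P f + Pv R f) (λ f → Pc P f + (f c + Pc R f))
  append (stop x) c p R = line (step c p R)
    (λ f → cong (_+ Pv R f) (≡sym (+-identityʳ (f x)))) (λ f → refl)
  append (step {x} d q P) c p R with append P c p R
  ... | line P′ veq ceq = line (step d q P′)
    (λ f → trans (cong (f x +_) (veq f)) (≡sym (+-assoc (f x) (Pv P f) (Pv R f))))
    (λ f → trans (cong (f d +_) (ceq f)) (≡sym (+-assoc (f d) (Pc P f) (f c + Pc R f))))

  backwards : ∀ {x z l} (P : Path x z l) → Line z x (Pv P) (Pc P)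
  backwards (stop x) = line (stop x) (λ _ → refl) (λ _ → refl)
  backwards (step {x} c p P) with backwards P
  ... | line P′ veq ceq with append P′ c (~sym p) (stop x)
  ...   | line P″ veq′ ceq′ = line P″
    (λ f → trans (veq′ f) (trans (cong₂ _+_ (veq f) (+-identityʳ (f x))) (+-comm (Pv P f) (f x))))
    (λ f → trans (ceq′ f) (trans (cong₂ _+_ (ceq f) (+-identityʳ (f c))) (+-comm (Pc P f) (f c))))

  linearise : ∀ {a b} (W : Walk a b) → Line a b (Σv W) (Σc W)
  linearise (pt x) = line (stop x) (λ f → +-identityʳ (f x)) (λ _ → refl)
  linearise (join A c p B) with linearise A | linearise B
  ... | line P veq ceq | line R veq′ ceq′ with append P c p R
  ...   | line PR veq″ ceq″ = line PR
    (λ f → trans (veq″ f) (cong₂ _+_ (veq f) (veq′ f)))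
    (λ f → trans (ceq″ f) (cong₂ (λ i j → i + (f c + j)) (ceq f) (ceq′ f)))
  linearise (rev A) with linearise A
  ... | line P veq ceq with backwards P
  ...   | line P′ veq′ ceq′ = line P′ (λ f → trans (veq′ f) (veq f)) (λ f → trans (ceq′ f) (ceq f))

sum≤1⇒injective : ∀ {l n} (g : Fin l → Fin n) → (∀ w → sum (δ w ∘ g) ≤ 1) → Injective _≡_ _≡_ g
sum≤1⇒injective g h {i} {j} eq with i ≟ j
... | yes i≡j = i≡j
... | no  i≢j = contradiction (≤-trans (sum≥two (δ (g i) ∘ g) i j i≢j) (h (g i)))
                  (<⇒≱ (≤-reflexive (≡sym (cong₂ _+_ (δ-refl (g i)) (trans (cong (δ (g i)) (≡sym eq)) (δ-refl (g i)))))))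

rainbowHamPath : ∀ {k} (G : Collection (suc k) (suc k)) {u v Q} (W : Walks.Walk G u v) →
                 Forests.Forest G [] ((_ , _ , W) ∷ []) Q → RainbowHamPath G u v
rainbowHamPath {k} G {Q = Q} W F = from (linearise W)
  where
  open Forests G
  open Linearisation G
  open ≡-Reasoning
  len≡k : (P : Line _ _ (Σv W) (Σc W)) → Line.len P ≡ k
  len≡k (line {l} P veq ceq) = cong pred (begin
      suc l                     ≡⟨ cong suc (sum-one l) ⟨
      suc (Pc P (λ _ → 1))      ≡⟨ cong suc (ceq (λ _ → 1)) ⟩
      suc (edges W)             ≡⟨ cong suc (trans (+-identityʳ _) (+-identityʳ _)) ⟨
      suc (edges W + 0 + 0)     ≡⟨ order F ⟩
      suc k                     ∎)
  from : Line _ _ (Σv W) (Σc W) → RainbowHamPath G _ _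
  from L@(line P veq ceq) with refl ← len≡k L = vertex P , colour P
    , sum≤1⇒injective (vertex P) (λ w → ≤-reflexive (begin
        Pv P (δ w)              ≡⟨ veq (δ w) ⟩
        Σv W (δ w)              ≡⟨ trans (+-identityʳ _) (+-identityʳ _) ⟨
        Σv W (δ w) + 0 + 0      ≡⟨ cov F (δ w) ⟩
        sum (δ w)               ≡⟨ sum-δ w ⟩
        1                       ∎))
    , refl , vertex-last P
    , sum≤1⇒injective (colour P) (λ c → ≤-trans (m≤m+n _ (total (δ c) Q)) (≤-reflexive (begin
        Pc P (δ c) + total (δ c) Q      ≡⟨ cong (_+ total (δ c) Q) (ceq (δ c)) ⟩
        Σc W (δ c) + total (δ c) Q      ≡⟨ cong (_+ total (δ c) Q) (+-identityʳ _) ⟨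
        Σc W (δ c) + 0 + total (δ c) Q  ≡⟨ col F (δ c) ⟩
        sum (δ c)                       ≡⟨ sum-δ c ⟩
        1                               ∎)))
    , colour-edge P

-- Deciding the existence of a rainbow path

-- The search runs over the head and then over the tail. `resp` enters because a function is
-- recovered from these only up to pointwise equality.
any-function? : ∀ {a b} {P : (Fin a → Fin b) → Set} → (∀ {f g} → f ≗ g → P f → P g) →
                (∀ f → Dec (P f)) → Dec (Σ (Fin a → Fin b) P)
any-function? {zero} resp P? =
  map′ (λ p → []ᶠ , p) (λ { (f , p) → resp (λ ()) p }) (P? []ᶠ)
any-function? {suc a} {P = P} resp P? =
  map′ (λ { (y , f , p) → y ∷ᶠ f , p })
       (λ { (f , p) → head f , tail f , resp (λ { zero → refl ; (suc i) → refl }) p })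
       (any? λ y → any-function? {P = λ f → P (y ∷ᶠ f)}
                     (λ eq → resp λ { zero → refl ; (suc i) → eq i })
                     (λ f → P? (y ∷ᶠ f)))

injective? : ∀ {a b} (f : Fin a → Fin b) → Dec (Injective _≡_ _≡_ f)
injective? f = map′ (λ h {i} {j} → h i j) (λ h i j → h) (all? λ i → all? λ j → (f i ≟ f j) →-dec (i ≟ j))

injective-≗ : ∀ {a b} {f g : Fin a → Fin b} → f ≗ g → Injective _≡_ _≡_ f → Injective _≡_ _≡_ g
injective-≗ eq inj {i} {j} h = inj (trans (eq i) (trans h (≡sym (eq j))))

-- (B2) and (B3) are derived from the absence of a path; a finite search replaces the appeal to
-- excluded middle.
rainbowHamPath? : ∀ {m k} (G : Collection m (suc k)) u v → Dec (RainbowHamPath G u v)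
rainbowHamPath? {m} {k} G u v =
  any-function?
    (λ eq → λ { (c , ip , pu , pv , ic , h) →
       c , injective-≗ eq ip , trans (≡sym (eq zero)) pu , trans (≡sym (eq (fromℕ k))) pv , ic ,
       λ i → trans (cong₂ (adj (G (c i))) (≡sym (eq (inject₁ i))) (≡sym (eq (suc i)))) (h i) })
    λ p → any-function?
      (λ eq → λ { (ip , pu , pv , ic , h) → ip , pu , pv , injective-≗ eq ic ,
         λ i → trans (cong (λ c → adj (G c) (p (inject₁ i)) (p (suc i))) (≡sym (eq i))) (h i) })
      λ c → injective? p ×-dec (p zero ≟ u) ×-dec (p (fromℕ k) ≟ v) ×-dec injective? c ×-dec
            all? λ i → adj (G (c i)) (p (inject₁ i)) (p (suc i)) ≟ᵇ true

-- Assembly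

b2⊎b3 : ∀ {n} (G : Collection n n) → (∀ i → σ₂≥ (G i) n) → ∀ {u v} → u ≢ v →
            (∀ {Q} (W : Walks.Walk G u v) → ¬ Forests.Forest G [] ((_ , _ , W) ∷ []) Q) →
            OutcomeB2 G u v ⊎ OutcomeB3 G u v
b2⊎b3 {n} G σ {u} {v} u≢v noPath = finish (reduce refl _ singletons refl)
  where
  open Ore G σ
  single : Fin n → Tree
  single w = ⟨ pt w ⟩

  pick : ∀ {w} xs → 0 < total (δ w) xs → ∃[ ys ] Pick xs w ys
  pick {w} xs p with _ , ys , pk , d ← pick-pos (δ w) xs p
                with refl ← δ-pos {w = w} d = ys , pk

  total-all : ∀ f → total f (allFin n) ≡ sum f
  total-all f = total-tabulate f (λ i → i)

  pick-v : ∃[ ys ] Pick (allFin n) v ys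
  pick-v = pick (allFin n) (subst (0 <_) (≡sym (trans (total-all (δ v)) (sum-δ v))) z<s)

  pick-u : ∃[ ys ] Pick (proj₁ pick-v) u ys
  pick-u = pick _ (subst (0 <_) (begin
    1                                            ≡⟨ sum-δ u ⟨
    sum (δ u)                                    ≡⟨ total-all (δ u) ⟨
    total (δ u) (allFin n)                       ≡⟨ total-pick (δ u) (proj₂ pick-v) ⟩
    δ u v + total (δ u) (proj₁ pick-v)           ≡⟨ cong (_+ total (δ u) (proj₁ pick-v)) (δ-≢ u≢v) ⟩
    total (δ u) (proj₁ pick-v)                   ∎) z<s)
    where open ≡-Reasoning

  inside : List (Fin n)
  inside = proj₁ pick-u

  Vs-single : ∀ f xs → Vs (map single xs) f ≡ total f xs
  Vs-single f []       = refl
  Vs-single f (x ∷ xs) = cong (f x +_) (Vs-single f xs)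

  Cs-single : ∀ f xs → Cs (map single xs) f ≡ 0
  Cs-single f []       = refl
  Cs-single f (x ∷ xs) = Cs-single f xs

  rotate₃ : ∀ a b c → a + (b + (c + 0)) ≡ c + (b + a)
  rotate₃ = solve-∀

  singletons : Forest (u ∷ v ∷ []) (map single inside) (allFin n)
  singletons = forest
    (λ f → begin
      Vs (map single inside) f + (f u + (f v + 0))  ≡⟨ cong (_+ (f u + (f v + 0))) (Vs-single f inside) ⟩
      total f inside + (f u + (f v + 0))            ≡⟨ rotate₃ (total f inside) (f u) (f v) ⟩
      f v + (f u + total f inside)                  ≡⟨ cong (f v +_) (total-pick f (proj₂ pick-u)) ⟨
      f v + total f (proj₁ pick-v)                  ≡⟨ total-pick f (proj₂ pick-v) ⟨
      total f (allFin n)                            ≡⟨ total-all f ⟩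
      sum f                                         ∎)
    (λ f → trans (cong (_+ total f (allFin n)) (Cs-single f inside)) (total-all f))
    where open ≡-Reasoning

  finish : ∃[ L ] ∃[ Q ] Forest (u ∷ v ∷ []) L Q × length L ≤ 2 → OutcomeB2 G u v ⊎ OutcomeB3 G u v
  -- Without inner vertices n = 2, and the single vertex `u` is already a walk covering everything
  -- but `v`.
  finish ([] , _ , F , _) = ⊥-elim (no-u-path noPath _ (grow F))
  finish (⟨ W ⟩ ∷ [] , _ , F , _) = ⊥-elim (no-inner-path noPath W F)
  finish (⟨ W₁ ⟩ ∷ ⟨ W₂ ⟩ ∷ [] , α ∷ β ∷ γ ∷ κ ∷ [] , F , _) =
    Extremal.near-outcome G σ (λ W → no-inner-path noPath W) F
  finish (⟨ W₁ ⟩ ∷ ⟨ W₂ ⟩ ∷ [] , [] , F , _) with () ← spares F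
  finish (⟨ W₁ ⟩ ∷ ⟨ W₂ ⟩ ∷ [] , _ ∷ [] , F , _) with () ← spares F
  finish (⟨ W₁ ⟩ ∷ ⟨ W₂ ⟩ ∷ [] , _ ∷ _ ∷ [] , F , _) with () ← spares F
  finish (⟨ W₁ ⟩ ∷ ⟨ W₂ ⟩ ∷ [] , _ ∷ _ ∷ _ ∷ [] , F , _) with () ← spares F
  finish (⟨ W₁ ⟩ ∷ ⟨ W₂ ⟩ ∷ [] , _ ∷ _ ∷ _ ∷ _ ∷ _ ∷ _ , F , _) with () ← spares F
  finish (_ ∷ _ ∷ _ ∷ _ , _ , _ , s≤s (s≤s ()))

theorem1p5 : (k : ℕ) (G : Collection (suc k) (suc k)) →
    (∀ i → σ₂≥ (G i) (suc k)) →
    (u v : Fin (suc k)) → u ≢ v →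
    RainbowHamPath G u v ⊎ OutcomeB2 G u v ⊎ OutcomeB3 G u v
theorem1p5 k G σ u v u≢v with rainbowHamPath? G u v
... | yes path = inj₁ path
... | no ¬path = inj₂ (b2⊎b3 G σ u≢v λ W F → ¬path (rainbowHamPath G W F))
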